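{- For the best-choice prophet inequality problem, there is an algorithm that succeeds with probability at least $\frac{1}{e}$ (on every instance).
   Context: Best-choice prophet inequality problem: an instance is a finite collection of probability distributions $D_1,\ldots,D_n$ on the real numbers, known to the algorithm in advance. Values $x_1,\ldots,x_n$ are drawn independently, $x_i\sim D_i$, and are presented to the algorithm one at a time, in an arbitrary order that is not known to the algorithm in advance. When a value is observed, the algorithm must irrevocably decide whether or not to choose it. Once a value is chosen the process stops; a value that was observed but not chosen cannot be chosen later. The algorithm succeeds if the value it chooses equals $\max_i x_i$. Distributions are assumed to be atomless (continuous). -}

module Defs where

open import Algebra.Bundles using (CommutativeRing; Semiring)
import Algebra.Definitions.RawSemiring as RawSemiringDefinitions
open import Data.Bool.Base using (Bool; true; false)
open import Data.Fin.Base as Fin using (Fin; toℕ; inject≤)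
open import Data.Fin.Permutation using (Permutation′; _⟨$⟩ʳ_)
open import Data.Fin.Properties using (toℕ<n)
open import Data.Nat.Base as ℕ using (ℕ; suc; _!)
open import Data.Product.Base using (Σ-syntax; ∃-syntax; _×_)
open import Data.Vec.Functional using (Vector)
open import Function.Base using (_∘_)
open import Level using (0ℓ) renaming (suc to lsuc)
open import Relation.Binary.Core using (Rel)
open import Relation.Binary.PropositionalEquality.Core using (_≡_; _≢_)
open import Relation.Binary.Structures using (IsTotalOrder)
import Relation.Binary.Construct.NonStrictToStrict as NonStrictToStrict
open import Relation.Unary using (Pred; _∈_; _≐_; _⊥_; U; ∁; ⋃; _⊢_; Satisfiable)

-- The real numbers are characterised axiomatically, as a Dedekind-complete
-- ordered field (unique up to isomorphism).  The inverse is a total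
-- operation, constrained only away from zero.

record CompleteOrderedField : Set₁ where
  infix  4 _≤_
  infix  8 _⁻¹
  field
    commutativeRing : CommutativeRing 0ℓ 0ℓ

  open CommutativeRing commutativeRing public

  field
    _≤_          : Rel Carrier 0ℓ
    _⁻¹          : Carrier → Carrier
    1≉0          : 1# ≉ 0#
    *-inverseʳ   : ∀ {x} → x ≉ 0# → x * x ⁻¹ ≈ 1#
    isTotalOrder : IsTotalOrder _≈_ _≤_
    +-monoˡ-≤    : ∀ {x y} z → x ≤ y → x + z ≤ y + z
    *-nonneg     : ∀ {x y} → 0# ≤ x → 0# ≤ y → 0# ≤ x * y

  UpperBound : Pred Carrier 0ℓ → Pred Carrier 0ℓ
  UpperBound S u = ∀ {x} → x ∈ S → x ≤ u

  field
    sup : ∀ (S : Pred Carrier 0ℓ) → Satisfiable S → Satisfiable (UpperBound S) →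
          ∃[ s ] (UpperBound S s × (∀ {u} → UpperBound S u → s ≤ u))

  open NonStrictToStrict _≈_ _≤_ public using (_<_)
  open RawSemiringDefinitions (Semiring.rawSemiring semiring) public
    using (sum; product) renaming (_×_ to _·_)

  fromℕ : ℕ → Carrier
  fromℕ n = n · 1#

record σ-Algebra (Ω : Set) : Set₂ where
  field
    Measurable : Pred (Pred Ω 0ℓ) (lsuc 0ℓ)
    resp-≐     : ∀ {A B} → A ≐ B → Measurable A → Measurable B
    univ       : Measurable U
    compl      : ∀ {A} → Measurable A → Measurable (∁ A)
    union      : ∀ {A : ℕ → Pred Ω 0ℓ} → (∀ k → Measurable (A k)) → Measurable (⋃ ℕ A)

module _ {Ω : Set} where

  data Generated (𝓖 : Pred (Pred Ω 0ℓ) 0ℓ) : Pred (Pred Ω 0ℓ) (lsuc 0ℓ) where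
    basic  : ∀ {A} → A ∈ 𝓖 → Generated 𝓖 A
    resp-≐ : ∀ {A B} → A ≐ B → Generated 𝓖 A → Generated 𝓖 B
    univ   : Generated 𝓖 U
    compl  : ∀ {A} → Generated 𝓖 A → Generated 𝓖 (∁ A)
    union  : ∀ {A : ℕ → Pred Ω 0ℓ} → (∀ k → Generated 𝓖 (A k)) → Generated 𝓖 (⋃ ℕ A)

  generatedBy : Pred (Pred Ω 0ℓ) 0ℓ → σ-Algebra Ω
  generatedBy 𝓖 = record
    { Measurable = Generated 𝓖
    ; resp-≐     = resp-≐
    ; univ       = univ
    ; compl      = compl
    ; union      = union
    }

open σ-Algebra using (Measurable)

module BestChoice (ℝ-field : CompleteOrderedField) where

  open CompleteOrderedField ℝ-field renaming (Carrier to ℝ)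

  Within : ℝ → ℝ → ℝ → Set
  Within ε x y = (x - ε < y) × (y < x + ε)

  HasSum : (ℕ → ℝ) → ℝ → Set
  HasSum a s = ∀ {ε} → 0# < ε →
    ∃[ N ] (∀ n → N ℕ.≤ n → Within ε s (sum {n} (a ∘ toℕ)))

  IsEuler : ℝ → Set
  IsEuler e = HasSum (λ k → fromℕ (k !) ⁻¹) e

  Open : Pred (Pred ℝ 0ℓ) 0ℓ
  Open A = ∀ {x} → x ∈ A → ∃[ ε ] (0# < ε × (∀ {y} → Within ε x y → y ∈ A))

  Borel : σ-Algebra ℝ
  Borel = generatedBy Open

  -- Open sets of ℝⁿ, for the maximum metric.
  Openⁿ : ∀ n → Pred (Pred (Vector ℝ n) 0ℓ) 0ℓ
  Openⁿ n A = ∀ {x} → x ∈ A →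
    ∃[ ε ] (0# < ε × (∀ {y} → (∀ i → Within ε (x i) (y i)) → y ∈ A))

  Borelⁿ : ∀ n → σ-Algebra (Vector ℝ n)
  Borelⁿ n = generatedBy (Openⁿ n)

  record ProbabilityMeasure {Ω : Set} (𝓕 : σ-Algebra Ω) : Set₁ where
    field
      Pr         : ∀ {A} → Measurable 𝓕 A → ℝ
      Pr-cong    : ∀ {A B} (a : Measurable 𝓕 A) (b : Measurable 𝓕 B) → A ≐ B → Pr a ≈ Pr b
      Pr-nonneg  : ∀ {A} (a : Measurable 𝓕 A) → 0# ≤ Pr a
      Pr-univ    : Pr (σ-Algebra.univ 𝓕) ≈ 1#
      σ-additive : ∀ {A : ℕ → Pred Ω 0ℓ} (a : ∀ k → Measurable 𝓕 (A k)) →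
                   (∀ {j k} → j ≢ k → A j ⊥ A k) →
                   HasSum (λ k → Pr (a k)) (Pr (σ-Algebra.union 𝓕 a))

  open ProbabilityMeasure using (Pr)

  Distribution : Set₁
  Distribution = ProbabilityMeasure Borel

  Atomless : Distribution → Set₁
  Atomless D = ∀ x (a : Measurable Borel (_≈ x)) → Pr D a ≈ 0#

  record Instance (n : ℕ) : Set₁ where
    field
      dist     : Fin n → Distribution
      atomless : ∀ i → Atomless (dist i)

  module _ {Ω : Set} (𝓕 : σ-Algebra Ω) (P : ProbabilityMeasure 𝓕) where

    record RandomVariable : Set₁ where
      field
        value      : Ω → ℝ
        measurable : ∀ {B} → Measurable Borel B → Measurable 𝓕 (value ⊢ B)

    open RandomVariable

    HasLaw : RandomVariable → Distribution → Set₁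
    HasLaw X D = ∀ {B} (b : Measurable Borel B) → Pr P (measurable X b) ≈ Pr D b

    -- Taking some of the B i to be the whole line gives the product rule for
    -- subfamilies.
    Independent : ∀ {n} → Vector RandomVariable n → Set₁
    Independent {n} X =
      ∀ {B : Fin n → Pred ℝ 0ℓ} (b : ∀ i → Measurable Borel (B i))
        (m : Measurable 𝓕 (λ ω → ∀ i → value (X i) ω ∈ B i)) →
      Pr P m ≈ product (λ i → Pr P (measurable (X i) (b i)))

  -- At each time k the rule sees the values presented at times 0, …, k and
  -- says whether to choose the last of them.
  record OnlineRule (n : ℕ) : Set₁ where
    field
      choose     : (k : Fin n) → Vector ℝ (suc (toℕ k)) → Bool
      measurable : ∀ k → Measurable (Borelⁿ (suc (toℕ k))) (λ v → choose k v ≡ true)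

  Algorithm : Set₁
  Algorithm = ∀ {n} → Instance n → OnlineRule n

  observed : ∀ {n} → Vector ℝ n → (k : Fin n) → Vector ℝ (suc (toℕ k))
  observed y k j = y (inject≤ j (toℕ<n k))

  StopsAt : ∀ {n} → OnlineRule n → Vector ℝ n → Fin n → Set
  StopsAt r y k = choose k (observed y k) ≡ true
                × (∀ j → j Fin.< k → choose j (observed y j) ≡ false)
    where open OnlineRule r

  IsMaximum : ∀ {n} → ℝ → Vector ℝ n → Set
  IsMaximum m x = (∃[ i ] m ≈ x i) × (∀ i → x i ≤ m)

  -- The value presented at time k is x (π ⟨$⟩ʳ k).
  Succeeds : ∀ {n} → OnlineRule n → Permutation′ n → Vector ℝ n → Set
  Succeeds r π x = ∃[ k ] (StopsAt r y k × IsMaximum (y k) x)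
    where y = λ k → x (π ⟨$⟩ʳ k)

  SucceedsWithProbabilityAtLeast : ℝ → ∀ {n} → OnlineRule n → Instance n → Set₂
  SucceedsWithProbabilityAtLeast p {n} r I =
    ∀ (π : Permutation′ n)
      {Ω : Set} (𝓕 : σ-Algebra Ω) (P : ProbabilityMeasure 𝓕)
      (X : Vector (RandomVariable 𝓕 P) n) →
    Independent 𝓕 P X →
    (∀ i → HasLaw 𝓕 P (X i) (Instance.dist I i)) →
    Σ[ m ∈ Measurable 𝓕 (λ ω → Succeeds r π (λ i → RandomVariable.value (X i) ω)) ]
      p ≤ Pr P m

{-# OPTIONS --safe #-}

-- The algorithm takes the first value above a threshold t at which
-- Pr(max xᵢ ≤ t) = ∏ qᵢ = 1/e, where qᵢ = Pr(xᵢ ≤ t); since the distributions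
-- are atomless, ∏ qᵢ is continuous in t and such a t exists.  Whatever the
-- order, the algorithm succeeds when exactly one value exceeds t, which has
-- probability Σᵢ (1 - qᵢ) ∏_{j ≠ i} qⱼ = (1/e) Σᵢ aᵢ with aᵢ = 1/qᵢ - 1.  As
-- ∏ (1 + aᵢ) = e, the inequality ∏ (1 + aᵢ) ≤ exp (Σ aᵢ) gives Σ aᵢ ≥ 1.  Only
-- partial sums of the exponential series are needed: ∏ (1 + aᵢ) ≤ Σ_{k ≤ n} sᵏ/k!
-- for s = Σ aᵢ, and the right-hand side is at most 1 + s (e - 1) < e if s < 1.

module Submission where

open import Defs
open import Axiom.ExcludedMiddle using (ExcludedMiddle)
open import Algebra.Bundles using (RawRing; Semiring)
import Algebra.Definitions.RawSemiring
import Algebra.Properties.Monoid.Sum as MonoidSum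
import Algebra.Properties.Semiring.Sum as SemiringSum
import Algebra.Solver.Ring as RingSolver
open import Algebra.Solver.Ring.AlmostCommutativeRing
  using (fromCommutativeRing; _-Raw-AlmostCommutative⟶_; Induced-equivalence)
open import Data.Bool.Base using (true; false)
open import Data.Empty using (⊥-elim)
open import Data.Fin.Base as Fin using (Fin; zero; suc; toℕ)
import Data.Fin.Permutation as Permutation
open import Data.Fin.Permutation using (Permutation′; _⟨$⟩ʳ_; _⟨$⟩ˡ_)
import Data.Fin.Properties as Fin
open import Data.Maybe.Base using (nothing; just)
open import Data.Nat.Base as ℕ using (ℕ; zero; suc; NonZero; _!)
import Data.Nat.Properties as ℕ
open import Data.Product.Base as Product using (Σ-syntax; ∃-syntax; _×_; _,_; proj₁; proj₂)
open import Data.Sum.Base as Sum using (_⊎_; inj₁; inj₂)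
open import Data.Unit.Base using (tt)
open import Data.Vec.Functional using (Vector)
open import Function.Base using (_∘_; case_of_)
open import Level using (0ℓ)
open import Relation.Binary.Bundles using (TotalOrder)
import Relation.Binary.Construct.NonStrictToStrict as NonStrictToStrict
open import Relation.Binary.Definitions using (WeaklyDecidable; tri<; tri≈; tri>)
open import Relation.Binary.PropositionalEquality.Core as ≡ using (_≡_; _≢_)
import Relation.Binary.Reasoning.PartialOrder as PartialOrderReasoning
open import Relation.Nullary.Decidable using (Dec; yes; no; does; decidable-stable; dec-true; dec-false)
open import Relation.Nullary.Negation.Core using (¬_; contradiction)
open import Relation.Unary using (Pred; _⊆_; _≐_; _⊥_; _∩_; _∪_; U; ∁; ∅; ⋃)

-- Why `1/e`: a threshold with ∏ qᵢ = c is exceeded by exactly one value with probability c Σ aᵢ,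
-- where ∏ (1 + aᵢ) = 1/c. The resulting bound c log (1/c) is largest at c = 1/e. Two obstacles
-- shape the formal argument. The success event must itself be shown measurable, which requires
-- comparing the variables with each other. And the reals are given only as a complete ordered
-- field: the Archimedean property and the rational points have to be derived from suprema, and
-- excluded middle decides the order, even inside the rule. Continuity of ∏ qᵢ and its limits at
-- both infinities all come from one fact: a decreasing sequence of events whose intersection lies
-- in a null set has vanishing probability.

uniform-bound : ∀ {n} {R : Fin n → ℕ → Set} → (∀ i → ∃[ K ] (∀ k → K ℕ.≤ k → R i k)) →
                ∃[ K ] (∀ i k → K ℕ.≤ k → R i k)
uniform-bound {zero}  bound = 0 , λ ()
uniform-bound {suc n} bound =
  let K₀ , r₀ = bound zero
      K , r   = uniform-bound (bound ∘ suc)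
  in K₀ ℕ.⊔ K , λ where
    zero    k K≤k → r₀ k (ℕ.≤-trans (ℕ.m≤m⊔n K₀ K) K≤k)
    (suc i) k K≤k → r i k (ℕ.≤-trans (ℕ.m≤n⊔m K₀ K) K≤k)

module _ (em : ExcludedMiddle 0ℓ) (ℝ-field : CompleteOrderedField) where

  -- Ring arithmetic and a solver with integer coefficients

  open CompleteOrderedField ℝ-field
    renaming (Carrier to ℝ; refl to ≈-refl; sym to ≈-sym; trans to ≈-trans; reflexive to ≈-reflexive)
    hiding (zero; isEquivalence)
  open BestChoice ℝ-field
  open import Algebra.Properties.Ring ring using (-‿distribˡ-*; -‿distribʳ-*)
  open import Algebra.Properties.AbelianGroup +-abelianGroup
    using (⁻¹-∙-comm; ⁻¹-involutive; ⁻¹-anti-homo‿-; ε⁻¹≈ε)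
  open import Algebra.Properties.CommutativeSemigroup +-commutativeSemigroup using (interchange)
  open Algebra.Definitions.RawSemiring (Semiring.rawSemiring semiring) using (_^_)
  private module Strict = NonStrictToStrict _≈_ _≤_
  import Algebra.Properties.Monoid.Mult.TCOptimised +-monoid as Optimised
  open import Algebra.Properties.Monoid.Mult +-monoid using (×-homo-+)
  open import Algebra.Properties.Semiring.Mult semiring using (×1-homo-*)

  -- Coefficients for the ring solver: (a , b) stands for the integer a − b.
  private
    ⟦_⟧ᶜ : ℕ × ℕ → ℝ
    -- Without a subtraction here, and with optimised multiples, `(0 , 0)` and `(1 , 0)` denote `0#`
    -- and `1#` by computation, so solved equations match their goals directly.
    ⟦ a , zero  ⟧ᶜ = a Optimised.× 1#
    ⟦ a , suc b ⟧ᶜ = a Optimised.× 1# - suc b Optimised.× 1#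

    ⟦⟧ᶜ-≈ : ∀ a b → ⟦ a , b ⟧ᶜ ≈ fromℕ a - fromℕ b
    ⟦⟧ᶜ-≈ a zero = ≈-trans (≈-sym (Optimised.×ᵤ≈× a 1#))
      (≈-trans (≈-sym (+-identityʳ _)) (+-congˡ (≈-sym ε⁻¹≈ε)))
    ⟦⟧ᶜ-≈ a (suc b) = +-cong (≈-sym (Optimised.×ᵤ≈× a 1#)) (-‿cong (≈-sym (Optimised.×ᵤ≈× (suc b) 1#)))

    -- Keeping one component zero makes equal normal forms of the solver
    -- syntactically equal.
    reduce : ℕ → ℕ → ℕ × ℕ
    reduce a b = a ℕ.∸ b , b ℕ.∸ a

    Coefficients : RawRing 0ℓ 0ℓ
    Coefficients = record
      { Carrier = ℕ × ℕ
      ; _≈_ = _≡_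
      ; _+_ = λ (a , b) (c , d) → reduce (a ℕ.+ c) (b ℕ.+ d)
      ; _*_ = λ (a , b) (c , d) → reduce (a ℕ.* c ℕ.+ b ℕ.* d) (a ℕ.* d ℕ.+ b ℕ.* c)
      ; -_  = λ (a , b) → b , a
      ; 0#  = 0 , 0
      ; 1#  = 1 , 0
      }

    -+-interchange : ∀ a b c d → (a - b) + (c - d) ≈ (a + c) - (b + d)
    -+-interchange a b c d = ≈-trans (interchange a (- b) c (- d)) (+-congˡ (⁻¹-∙-comm b d))

    -‿cancelʳ : ∀ z x y → (x + z) - (y + z) ≈ x - y
    -‿cancelʳ z x y = ≈-trans (≈-sym (-+-interchange x y z z)) (≈-trans (+-congˡ (-‿inverseʳ z)) (+-identityʳ _))

    ⟦reduce⟧-≈ : ∀ a b → ⟦ reduce a b ⟧ᶜ ≈ fromℕ a - fromℕ b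
    ⟦reduce⟧-≈ zero    zero    = ⟦⟧ᶜ-≈ 0 0
    ⟦reduce⟧-≈ zero    (suc b) = ⟦⟧ᶜ-≈ 0 (suc b)
    ⟦reduce⟧-≈ (suc a) zero    = ⟦⟧ᶜ-≈ (suc a) 0
    ⟦reduce⟧-≈ (suc a) (suc b) = ≈-trans (⟦reduce⟧-≈ a b)
      (≈-trans (≈-sym (-‿cancelʳ 1# _ _)) (+-cong (+-comm _ _) (-‿cong (+-comm _ _))))

    -*-expand : ∀ a b c d → (a - b) * (c - d) ≈ (a * c + b * d) - (a * d + b * c)
    -*-expand a b c d = begin
      (a - b) * (c - d)                            ≈⟨ distribʳ _ _ _ ⟩
      a * (c - d) + - b * (c - d)                  ≈⟨ +-cong (distribˡ _ _ _) (distribˡ _ _ _) ⟩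
      (a * c + a * - d) + (- b * c + - b * - d)    ≈⟨ +-cong (+-congˡ (≈-sym (-‿distribʳ-* a d)))
                                                       (≈-trans (+-comm _ _) (+-cong
                                                         (≈-trans (≈-sym (-‿distribˡ-* b (- d)))
                                                           (≈-trans (-‿cong (≈-sym (-‿distribʳ-* b d))) (⁻¹-involutive _)))
                                                         (≈-sym (-‿distribˡ-* b c)))) ⟩
      (a * c - a * d) + (b * d - b * c)            ≈⟨ -+-interchange _ _ _ _ ⟩
      (a * c + b * d) - (a * d + b * c)            ∎
      where open import Relation.Binary.Reasoning.Setoid setoid

    fromℕ-+ : ∀ m n → fromℕ (m ℕ.+ n) ≈ fromℕ m + fromℕ n
    fromℕ-+ = ×-homo-+ 1#

    fromℕ-*+ : ∀ a c b d → fromℕ (a ℕ.* c ℕ.+ b ℕ.* d) ≈ fromℕ a * fromℕ c + fromℕ b * fromℕ d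
    fromℕ-*+ a c b d = ≈-trans (fromℕ-+ (a ℕ.* c) (b ℕ.* d)) (+-cong (×1-homo-* a c) (×1-homo-* b d))

    coefficient-morphism : Coefficients -Raw-AlmostCommutative⟶ fromCommutativeRing commutativeRing
    coefficient-morphism = record
      { ⟦_⟧    = ⟦_⟧ᶜ
      ; +-homo = λ (a , b) (c , d) → ≈-trans (⟦reduce⟧-≈ (a ℕ.+ c) (b ℕ.+ d))
          (≈-trans (+-cong (fromℕ-+ a c) (-‿cong (fromℕ-+ b d)))
          (≈-trans (≈-sym (-+-interchange _ _ _ _)) (≈-sym (+-cong (⟦⟧ᶜ-≈ a b) (⟦⟧ᶜ-≈ c d)))))
      ; *-homo = λ (a , b) (c , d) → ≈-trans (⟦reduce⟧-≈ (a ℕ.* c ℕ.+ b ℕ.* d) (a ℕ.* d ℕ.+ b ℕ.* c))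
          (≈-trans (+-cong (fromℕ-*+ a c b d) (-‿cong (fromℕ-*+ a d b c)))
          (≈-trans (≈-sym (-*-expand _ _ _ _)) (≈-sym (*-cong (⟦⟧ᶜ-≈ a b) (⟦⟧ᶜ-≈ c d)))))
      ; -‿homo = λ (a , b) → ≈-trans (⟦⟧ᶜ-≈ b a)
          (≈-trans (≈-sym (⁻¹-anti-homo‿- _ _)) (-‿cong (≈-sym (⟦⟧ᶜ-≈ a b))))
      ; 0-homo = ≈-refl
      ; 1-homo = ≈-refl
      }

    coefficient-≟ : WeaklyDecidable (Induced-equivalence coefficient-morphism)
    coefficient-≟ (a , b) (c , d) with a ℕ.≟ c | b ℕ.≟ d
    ... | yes ≡.refl | yes ≡.refl = just ≈-refl
    ... | _          | _          = nothing

  module Solver = RingSolver Coefficients (fromCommutativeRing commutativeRing)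
                    coefficient-morphism coefficient-≟
  open Solver using (solve; _:=_; _:+_; _:*_; _:-_; :-_; Polynomial)

  :1 :0 : ∀ {n} → Polynomial n
  :1 = Solver.con (1 , 0)
  :0 = Solver.con (0 , 0)

  -- Order and inverses in the field

  totalOrder : TotalOrder 0ℓ 0ℓ 0ℓ
  totalOrder = record { isTotalOrder = isTotalOrder }

  open TotalOrder totalOrder
    using (poset; antisym; total; ≤-respʳ-≈; ≤-respˡ-≈)
    renaming (refl to ≤-refl; reflexive to ≤-reflexive; trans to ≤-trans)
  module ≤-Reasoning = PartialOrderReasoning poset

  <⇒≤ : ∀ {x y} → x < y → x ≤ y
  <⇒≤ = proj₁

  <⇒≱ : ∀ {x y} → x < y → ¬ y ≤ x
  <⇒≱ = Strict.<⇒≱ antisym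

  ≰⇒> : ∀ {x y} → ¬ x ≤ y → y < x
  ≰⇒> = Strict.≰⇒> ≈-sym ≤-reflexive total

  ≮⇒≥ : ∀ {x y} → ¬ x < y → y ≤ x
  ≮⇒≥ x≮y = decidable-stable em (x≮y ∘ ≰⇒>)

  ≤-<-trans : ∀ {x y z} → x ≤ y → y < z → x < z
  ≤-<-trans = Strict.≤-<-trans ≤-trans antisym ≤-respˡ-≈

  <-≤-trans : ∀ {x y z} → x < y → y ≤ z → x < z
  <-≤-trans = Strict.<-≤-trans ≈-sym ≤-trans antisym ≤-respʳ-≈

  +-mono-≤ : ∀ {x y z w} → x ≤ y → z ≤ w → x + z ≤ y + w
  +-mono-≤ {x} {y} {z} {w} x≤y z≤w = begin
    x + z  ≤⟨ +-monoˡ-≤ z x≤y ⟩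
    y + z  ≈⟨ +-comm y z ⟩
    z + y  ≤⟨ +-monoˡ-≤ y z≤w ⟩
    w + y  ≈⟨ +-comm w y ⟩
    y + w  ∎
    where open ≤-Reasoning

  +-nonneg : ∀ {x y} → 0# ≤ x → 0# ≤ y → 0# ≤ x + y
  +-nonneg 0≤x 0≤y = ≤-respˡ-≈ (+-identityˡ 0#) (+-mono-≤ 0≤x 0≤y)

  -- Linear inequalities are proved by exhibiting the difference of the two
  -- sides as a combination of gaps y - x of known inequalities x ≤ y.
  gap : ∀ {x y} → x ≤ y → 0# ≤ y - x
  gap {x} {y} x≤y = ≤-respˡ-≈ (-‿inverseʳ x) (+-monoˡ-≤ (- x) x≤y)

  ≤-by : ∀ {x y d} → 0# ≤ d → y - x ≈ d → x ≤ y
  ≤-by {x} {y} {d} 0≤d eq = begin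
    x            ≈⟨ +-identityˡ x ⟨
    0# + x       ≤⟨ +-monoˡ-≤ x 0≤d ⟩
    d + x        ≈⟨ +-congʳ eq ⟨
    (y - x) + x  ≈⟨ solve 2 (λ x y → (y :- x) :+ x := y) ≈-refl x y ⟩
    y            ∎
    where open ≤-Reasoning

  <-by : ∀ {x y d} → 0# < d → y - x ≈ d → x < y
  <-by {x} {y} {d} 0<d eq = ≰⇒> λ y≤x → <⇒≱ 0<d (≤-by (gap y≤x)
    (≈-trans (+-congˡ (-‿cong (≈-sym eq))) (solve 2 (λ x y → :0 :- (y :- x) := x :- y) ≈-refl x y)))

  gap< : ∀ {x y} → x < y → 0# < y - x
  gap< {x} {y} x<y = ≰⇒> λ d≤0 → <⇒≱ x<y (≤-by (gap d≤0)
    (solve 2 (λ x y → x :- y := :0 :- (y :- x)) ≈-refl x y))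

  +-pos-nonneg : ∀ {x y} → 0# < x → 0# ≤ y → 0# < x + y
  +-pos-nonneg {x} {y} 0<x 0≤y = <-≤-trans 0<x (≤-by 0≤y (solve 2 (λ x y → (x :+ y) :- x := y) ≈-refl x y))

  *-monoʳ-≤ : ∀ {x y z} → 0# ≤ z → x ≤ y → x * z ≤ y * z
  *-monoʳ-≤ {x} {y} {z} 0≤z x≤y = ≤-by (*-nonneg (gap x≤y) 0≤z)
    (solve 3 (λ x y z → y :* z :- x :* z := (y :- x) :* z) ≈-refl x y z)

  *-monoˡ-≤ : ∀ {x y z} → 0# ≤ z → x ≤ y → z * x ≤ z * y
  *-monoˡ-≤ {x} {y} {z} 0≤z x≤y = ≤-by (*-nonneg 0≤z (gap x≤y))
    (solve 3 (λ x y z → z :* y :- z :* x := z :* (y :- x)) ≈-refl x y z)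

  0≤1 : 0# ≤ 1#
  0≤1 with total 0# 1#
  ... | inj₁ 0≤1 = 0≤1
  -- If 1 ≤ 0, then 0 - 1 is nonnegative, and 1 is its square.
  ... | inj₂ 1≤0 = ≤-by (*-nonneg (gap 1≤0) (gap 1≤0))
    (solve 0 (:1 :- :0 := (:0 :- :1) :* (:0 :- :1)) ≈-refl)

  0<1 : 0# < 1#
  0<1 = 0≤1 , 1≉0 ∘ ≈-sym

  inverse-unique : ∀ {x y z} → x * y ≈ 1# → x * z ≈ 1# → y ≈ z
  inverse-unique {x} {y} {z} xy xz = begin
    y            ≈⟨ *-identityʳ y ⟨
    y * 1#       ≈⟨ *-congˡ xz ⟨
    y * (x * z)  ≈⟨ solve 3 (λ x y z → y :* (x :* z) := (x :* y) :* z) ≈-refl x y z ⟩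
    (x * y) * z  ≈⟨ *-congʳ xy ⟩
    1# * z       ≈⟨ *-identityˡ z ⟩
    z            ∎
    where open import Relation.Binary.Reasoning.Setoid setoid

  >⇒≉ : ∀ {x y} → x < y → y ≉ x
  >⇒≉ x<y = proj₂ x<y ∘ ≈-sym

  pos-inverse : ∀ {x} → 0# < x → x * x ⁻¹ ≈ 1#
  pos-inverse 0<x = *-inverseʳ (>⇒≉ 0<x)

  ⁻¹-pos : ∀ {x} → 0# < x → 0# < x ⁻¹
  ⁻¹-pos {x} 0<x = ≰⇒> λ x⁻¹≤0 → <⇒≱ 0<1 (begin
    1#        ≈⟨ pos-inverse 0<x ⟨
    x * x ⁻¹  ≤⟨ *-monoˡ-≤ (<⇒≤ 0<x) x⁻¹≤0 ⟩
    x * 0#    ≈⟨ zeroʳ x ⟩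
    0#        ∎)
    where open ≤-Reasoning

  *-pos : ∀ {x y} → 0# < x → 0# < y → 0# < x * y
  *-pos {x} {y} 0<x 0<y = *-nonneg (<⇒≤ 0<x) (<⇒≤ 0<y) , λ 0≈xy → proj₂ 0<y (begin
    0#              ≈⟨ zeroʳ _ ⟨
    x ⁻¹ * 0#       ≈⟨ *-congˡ 0≈xy ⟩
    x ⁻¹ * (x * y)  ≈⟨ solve 3 (λ x y z → z :* (x :* y) := (x :* z) :* y) ≈-refl x y (x ⁻¹) ⟩
    (x * x ⁻¹) * y  ≈⟨ *-congʳ (pos-inverse 0<x) ⟩
    1# * y          ≈⟨ *-identityˡ y ⟩
    y               ∎)
    where open import Relation.Binary.Reasoning.Setoid setoid

  *-monoʳ-< : ∀ {x y z} → 0# < z → x < y → x * z < y * z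
  *-monoʳ-< {x} {y} {z} 0<z x<y = <-by (*-pos (gap< x<y) 0<z)
    (solve 3 (λ x y z → y :* z :- x :* z := (y :- x) :* z) ≈-refl x y z)

  fromℕ-nonneg : ∀ n → 0# ≤ fromℕ n
  fromℕ-nonneg zero    = ≤-refl
  fromℕ-nonneg (suc n) = +-nonneg 0≤1 (fromℕ-nonneg n)

  fromℕ-pos : ∀ n → 0# < fromℕ (suc n)
  fromℕ-pos n = +-pos-nonneg 0<1 (fromℕ-nonneg n)

  fromℕ-mono-≤ : ∀ {m n} → m ℕ.≤ n → fromℕ m ≤ fromℕ n
  fromℕ-mono-≤ {n = n} ℕ.z≤n = fromℕ-nonneg n
  fromℕ-mono-≤ (ℕ.s≤s m≤n) = +-mono-≤ ≤-refl (fromℕ-mono-≤ m≤n)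

  -- The Archimedean property and a countable dense grid

  abstract
    -- If the naturals were bounded, let `s` be their supremum. Since n + 1 ≤ s for every n, the
    -- smaller number s - 1 would be an upper bound as well.
    archimedean : ∀ x → ∃[ n ] x < fromℕ n
    archimedean x = decidable-stable em λ bounded →
      let s , ub , lub = sup (λ y → ∃[ n ] y ≈ fromℕ n) (0# , 0 , ≈-refl)
            (x , λ (n , y≈n) → ≤-respˡ-≈ (≈-sym y≈n) (≮⇒≥ λ x<n → bounded (n , x<n)))
          s≤s-1 = lub {s - 1#} λ {y} (n , y≈n) →
            ≤-by (gap (ub (suc n , ≈-refl)))
              (≈-trans (+-congˡ (-‿cong y≈n)) (solve 2 (λ s n → s :- :1 :- n := s :- (:1 :+ n)) ≈-refl s (fromℕ n)))
      in <⇒≱ 0<1 (≤-by (gap s≤s-1) (solve 1 (λ s → :0 :- :1 := s :- :1 :- s) ≈-refl s))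

  -- The null sequence 1/(k + 1); it replaces an arbitrary positive real wherever limits must run
  -- over a countable index.
  δ : ℕ → ℝ
  δ k = fromℕ (suc k) ⁻¹

  δ-pos : ∀ k → 0# < δ k
  δ-pos k = ⁻¹-pos (fromℕ-pos k)

  δ-inverse : ∀ k → fromℕ (suc k) * δ k ≈ 1#
  δ-inverse k = pos-inverse (fromℕ-pos k)

  δ-mono : ∀ {j k} → j ℕ.≤ k → δ k ≤ δ j
  δ-mono {j} {k} j≤k = begin
    δ k                            ≈⟨ *-identityˡ _ ⟨
    1# * δ k                       ≈⟨ *-congʳ (δ-inverse j) ⟨
    (fromℕ (suc j) * δ j) * δ k    ≤⟨ *-monoʳ-≤ (<⇒≤ (δ-pos k)) (*-monoʳ-≤ (<⇒≤ (δ-pos j)) (fromℕ-mono-≤ (ℕ.s≤s j≤k))) ⟩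
    (fromℕ (suc k) * δ j) * δ k    ≈⟨ solve 3 (λ m x y → (m :* x) :* y := (m :* y) :* x) ≈-refl (fromℕ (suc k)) (δ j) (δ k) ⟩
    (fromℕ (suc k) * δ k) * δ j    ≈⟨ *-congʳ (δ-inverse k) ⟩
    1# * δ j                       ≈⟨ *-identityˡ _ ⟩
    δ j                            ∎
    where open ≤-Reasoning

  abstract
    δ-small : ∀ {ε} → 0# < ε → ∃[ k ] δ k < ε
    δ-small {ε} 0<ε = let k , ε⁻¹<k = archimedean (ε ⁻¹) in k , (begin-strict
      δ k                              ≈⟨ *-identityˡ _ ⟨
      1# * δ k                         ≈⟨ *-congʳ (pos-inverse 0<ε) ⟨
      (ε * ε ⁻¹) * δ k                 ≈⟨ solve 3 (λ m x y → (m :* x) :* y := x :* (m :* y)) ≈-refl ε (ε ⁻¹) (δ k) ⟩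
      ε ⁻¹ * (ε * δ k)                 <⟨ *-monoʳ-< (*-pos 0<ε (δ-pos k)) (<-≤-trans ε⁻¹<k (fromℕ-mono-≤ (ℕ.n≤1+n k))) ⟩
      fromℕ (suc k) * (ε * δ k)        ≈⟨ solve 3 (λ m x y → m :* (x :* y) := (m :* y) :* x) ≈-refl (fromℕ (suc k)) ε (δ k) ⟩
      (fromℕ (suc k) * δ k) * ε        ≈⟨ *-congʳ (δ-inverse k) ⟩
      1# * ε                           ≈⟨ *-identityˡ ε ⟩
      ε                                ∎)
      where open ≤-Reasoning

  -- The rationals, as (a - b)/(k + 1). Three natural indices allow a union over them to be taken as
  -- three nested countable unions.
  grid : ℕ → ℕ → ℕ → ℝ
  grid k a b = (fromℕ a - fromℕ b) * δ k

  module _ {x y : ℝ} (k b : ℕ) (δ<y-x : δ k < y - x) (-x/δ<b : - x * fromℕ (suc k) < fromℕ b) where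

    open ≤-Reasoning

    private
      /δ : ∀ z → (z * fromℕ (suc k)) * δ k ≈ z
      /δ z = ≈-trans (*-assoc _ _ _) (≈-trans (*-congˡ (δ-inverse k)) (*-identityʳ z))

    below-grid : ∀ a → x * fromℕ (suc k) + fromℕ b < fromℕ a → x < grid k a b
    below-grid a x/δ+b<a = begin-strict
      x                           ≈⟨ /δ x ⟨
      (x * fromℕ (suc k)) * δ k   <⟨ *-monoʳ-< (δ-pos k) (<-by (gap< x/δ+b<a)
        (solve 3 (λ x a b → (a :- b) :- x := a :- (x :+ b)) ≈-refl (x * fromℕ (suc k)) (fromℕ a) (fromℕ b))) ⟩
      grid k a b                  ∎

    grid-0≤x : grid k 0 b ≤ x
    grid-0≤x = <⇒≤ (begin-strict
      grid k 0 b                  <⟨ *-monoʳ-< (δ-pos k) (<-by (gap< -x/δ<b)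
        (solve 3 (λ x m b → (x :* m) :- (:0 :- b) := b :- (:- x :* m)) ≈-refl x (fromℕ (suc k)) (fromℕ b))) ⟩
      (x * fromℕ (suc k)) * δ k   ≈⟨ /δ x ⟩
      x                           ∎)

    grid-next<y : ∀ a → grid k a b ≤ x → grid k (suc a) b < y
    grid-next<y a g≤x = <-by (+-pos-nonneg (gap< δ<y-x) (gap g≤x))
      (solve 5 (λ a b d x y → y :- ((:1 :+ a) :- b) :* d := ((y :- x) :- d) :+ (x :- (a :- b) :* d))
        ≈-refl (fromℕ a) (fromℕ b) (δ k) x y)

    -- Lowering `a` until the preceding grid point is at most `x` yields a point above `x` by at
    -- most one step `δ k`, which is shorter than y - x. The descent ends because `grid k 0 b` is
    -- already at most `x`.
    least-above : ∀ a → x < grid k a b → ∃[ a ] (x < grid k a b × grid k a b < y)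
    least-above zero    x<g = contradiction grid-0≤x (<⇒≱ x<g)
    least-above (suc a) x<g = case em {x < grid k a b} of λ where
      (yes x<g′) → least-above a x<g′
      (no  x≮g′) → suc a , x<g , grid-next<y a (≮⇒≥ x≮g′)

  abstract
    grid-dense : ∀ {x y} → x < y → ∃[ k ] ∃[ a ] ∃[ b ] (x < grid k a b × grid k a b < y)
    grid-dense {x} {y} x<y =
      let k , δ<y-x   = δ-small (gap< x<y)
          b , -x/δ<b  = archimedean (- x * fromℕ (suc k))
          a , x/δ+b<a = archimedean (x * fromℕ (suc k) + fromℕ b)
          a′ , x<g , g<y = least-above k b δ<y-x -x/δ<b a (below-grid k b δ<y-x -x/δ<b a x/δ+b<a)
      in k , a′ , b , x<g , g<y

  -- Limits of series

  ≈-by-Within : ∀ {x y} → (∀ {ε} → 0# < ε → Within ε x y) → x ≈ y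
  ≈-by-Within {x} {y} close = antisym
    (≮⇒≥ λ y<x → <⇒≱ (proj₁ (close (gap< y<x))) (≤-reflexive (solve 2 (λ x y → y := x :- (x :- y)) ≈-refl x y)))
    (≮⇒≥ λ x<y → <⇒≱ (proj₂ (close (gap< x<y))) (≤-reflexive (solve 2 (λ x y → x :+ (y :- x) := y) ≈-refl x y)))

  partial : (ℕ → ℝ) → ℕ → ℝ
  partial a n = sum {n} (a ∘ toℕ)

  partial-suc : ∀ a n → partial a (suc n) ≈ partial a n + a n
  partial-suc a zero    = +-comm _ _
  partial-suc a (suc n) = ≈-trans (+-congˡ (partial-suc (a ∘ suc) n)) (≈-sym (+-assoc _ _ _))

  partial-mono : ∀ {a} → (∀ k → 0# ≤ a k) → ∀ {m n} → m ℕ.≤ n → partial a m ≤ partial a n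
  partial-mono 0≤a {n = zero}  ℕ.z≤n = ≤-refl
  partial-mono 0≤a {n = suc n} ℕ.z≤n = +-nonneg (0≤a 0) (partial-mono (0≤a ∘ suc) {n = n} ℕ.z≤n)
  partial-mono 0≤a (ℕ.s≤s m≤n) = +-mono-≤ ≤-refl (partial-mono (0≤a ∘ suc) m≤n)

  -- A partial sum above `s` would keep all later ones above `s` by at least the same margin, which
  -- then serves as the ε refuting convergence.
  partial≤HasSum : ∀ {a s} → (∀ k → 0# ≤ a k) → HasSum a s → ∀ n → partial a n ≤ s
  partial≤HasSum {a} {s} 0≤a a→s n = ≮⇒≥ λ s<p →
    let N , close = a→s (gap< s<p)
    in <⇒≱ (proj₂ (close (n ℕ.⊔ N) (ℕ.m≤n⊔m n N))) (begin
      s + (partial a n - s)    ≈⟨ solve 2 (λ s p → s :+ (p :- s) := p) ≈-refl s (partial a n) ⟩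
      partial a n              ≤⟨ partial-mono 0≤a (ℕ.m≤m⊔n n N) ⟩
      partial a (n ℕ.⊔ N)      ∎)
    where open ≤-Reasoning

  eventually-constant⇒limit : ∀ {a s t} N → (∀ n → partial a (N ℕ.+ n) ≈ t) → HasSum a s → s ≈ t
  eventually-constant⇒limit {a} {s} {t} N constant a→s = ≈-by-Within λ 0<ε →
    let M , close = a→s 0<ε
        lower , upper = close (N ℕ.+ M) (ℕ.m≤n+m M N)
    in <-≤-trans lower (≤-reflexive (constant M)) , ≤-<-trans (≤-reflexive (≈-sym (constant M))) upper

  -- Finite products and sums

  open MonoidSum *-monoid using () renaming (sum-cong-≋ to product-cong)
  open MonoidSum +-monoid using (sum-cong-≋)
  open SemiringSum semiring using (*-distribʳ-sum)

  UnitInterval : ℝ → Set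
  UnitInterval x = 0# ≤ x × x ≤ 1#

  product-∈[0,1] : ∀ {n} {x : Vector ℝ n} → (∀ i → UnitInterval (x i)) → UnitInterval (product x)
  product-∈[0,1] {zero}  h = 0≤1 , ≤-refl
  product-∈[0,1] {suc n} {x} h =
    let 0≤P , P≤1 = product-∈[0,1] (h ∘ suc)
        0≤x , x≤1 = h zero
    in *-nonneg 0≤x 0≤P , (begin
      x zero * product (x ∘ suc)  ≤⟨ *-monoʳ-≤ 0≤P x≤1 ⟩
      1# * product (x ∘ suc)      ≈⟨ *-identityˡ _ ⟩
      product (x ∘ suc)           ≤⟨ P≤1 ⟩
      1#                          ∎)
    where open ≤-Reasoning

  product-mono-≤ : ∀ {n} {x y : Vector ℝ n} → (∀ i → 0# ≤ x i) → (∀ i → 0# ≤ y i) →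
                   (∀ i → x i ≤ y i) → product x ≤ product y
  product-mono-≤ {zero}  0≤x 0≤y x≤y = ≤-refl
  product-mono-≤ {suc n} {x} {y} 0≤x 0≤y x≤y = begin
    x zero * product (x ∘ suc)  ≤⟨ *-monoˡ-≤ (0≤x zero) (product-mono-≤ (0≤x ∘ suc) (0≤y ∘ suc) (x≤y ∘ suc)) ⟩
    x zero * product (y ∘ suc)  ≤⟨ *-monoʳ-≤ (product-nonneg (0≤y ∘ suc)) (x≤y zero) ⟩
    y zero * product (y ∘ suc)  ∎
    where
    open ≤-Reasoning
    product-nonneg : ∀ {n} {x : Vector ℝ n} → (∀ i → 0# ≤ x i) → 0# ≤ product x
    product-nonneg {zero}  0≤x = 0≤1
    product-nonneg {suc n} 0≤x = *-nonneg (0≤x zero) (product-nonneg (0≤x ∘ suc))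

  -- Factors are exchanged one at a time; each exchange costs at most `η` because all other factors
  -- lie in [0, 1]. This transfers closeness of the individual distribution functions to their
  -- product.
  product-perturb : ∀ {n} {x y : Vector ℝ n} {η} → 0# ≤ η →
    (∀ i → UnitInterval (x i)) → (∀ i → UnitInterval (y i)) →
    (∀ i → y i ≤ x i + η) → product y ≤ product x + fromℕ n * η
  product-perturb {zero} {η = η} _ _ _ _ = ≤-reflexive (solve 1 (λ η → :1 := :1 :+ :0 :* η) ≈-refl η)
  product-perturb {suc n} {x} {y} {η} 0≤η x∈ y∈ y≤x+η =
    let Y = product (y ∘ suc)
        X = product (x ∘ suc)
        0≤Y , Y≤1 = product-∈[0,1] (y∈ ∘ suc)
        0≤x , x≤1 = x∈ zero
    in begin
      y zero * Y                        ≤⟨ *-monoʳ-≤ 0≤Y (y≤x+η zero) ⟩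
      (x zero + η) * Y                  ≈⟨ distribʳ _ _ _ ⟩
      x zero * Y + η * Y                ≤⟨ +-mono-≤ (*-monoˡ-≤ 0≤x (product-perturb 0≤η (x∈ ∘ suc) (y∈ ∘ suc) (y≤x+η ∘ suc)))
                                                    (*-monoˡ-≤ 0≤η Y≤1) ⟩
      x zero * (X + fromℕ n * η) + η * 1#    ≈⟨ solve 4 (λ x X n η → x :* (X :+ n :* η) :+ η :* :1 := x :* X :+ (x :* (n :* η) :+ η))
                                                  ≈-refl (x zero) X (fromℕ n) η ⟩
      x zero * X + (x zero * (fromℕ n * η) + η)  ≤⟨ +-mono-≤ ≤-refl (+-mono-≤ (*-monoʳ-≤ (*-nonneg (fromℕ-nonneg n) 0≤η) x≤1) ≤-refl) ⟩
      x zero * X + (1# * (fromℕ n * η) + η)  ≈⟨ +-congˡ (solve 2 (λ n η → :1 :* (n :* η) :+ η := (:1 :+ n) :* η) ≈-refl (fromℕ n) η) ⟩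
      x zero * X + fromℕ (suc n) * η         ∎
    where open ≤-Reasoning

  -- Serves to evaluate (1 - qᵢ) ∏_{j ≠ i} qⱼ without forming a product over the remaining indices:
  -- the exceptional factor is written as aᵢ qᵢ and aᵢ is pulled out.
  product-scale-at : ∀ {n} {q w : Vector ℝ n} {a} i → w i ≈ a * q i → (∀ j → j ≢ i → w j ≈ q j) →
                     product w ≈ a * product q
  product-scale-at {suc n} {q} {w} {a} zero wi wj = begin
    w zero * product (w ∘ suc)        ≈⟨ *-cong wi (product-cong (λ j → wj (suc j) λ ())) ⟩
    (a * q zero) * product (q ∘ suc)  ≈⟨ *-assoc _ _ _ ⟩
    a * (q zero * product (q ∘ suc))  ∎
    where open import Relation.Binary.Reasoning.Setoid setoid
  product-scale-at {suc n} {q} {w} {a} (suc i) wi wj = begin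
    w zero * product (w ∘ suc)        ≈⟨ *-cong (wj zero λ ()) (product-scale-at i wi (λ j j≢i → wj (suc j) (j≢i ∘ Fin.suc-injective))) ⟩
    q zero * (a * product (q ∘ suc))  ≈⟨ solve 3 (λ a q Q → q :* (a :* Q) := a :* (q :* Q)) ≈-refl a (q zero) (product (q ∘ suc)) ⟩
    a * (q zero * product (q ∘ suc))  ∎
    where open import Relation.Binary.Reasoning.Setoid setoid

  product-* : ∀ {n} (x y : Vector ℝ n) → product (λ i → x i * y i) ≈ product x * product y
  product-* {zero}  x y = ≈-sym (*-identityˡ 1#)
  product-* {suc n} x y = ≈-trans (*-congˡ (product-* (x ∘ suc) (y ∘ suc)))
    (solve 4 (λ x y X Y → (x :* y) :* (X :* Y) := (x :* X) :* (y :* Y)) ≈-refl (x zero) (y zero) (product (x ∘ suc)) (product (y ∘ suc)))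

  product-1 : ∀ n → product {n} (λ _ → 1#) ≈ 1#
  product-1 zero    = ≈-refl
  product-1 (suc n) = ≈-trans (*-identityˡ _) (product-1 n)

  product≉0⇒factor≉0 : ∀ {n} {x : Vector ℝ n} → product x ≉ 0# → ∀ i → x i ≉ 0#
  product≉0⇒factor≉0 {suc n} {x} P≉0 zero    x≈0 = P≉0 (≈-trans (*-congʳ x≈0) (zeroˡ _))
  product≉0⇒factor≉0 {suc n} {x} P≉0 (suc i) =
    product≉0⇒factor≉0 (λ P≈0 → P≉0 (≈-trans (*-congˡ P≈0) (zeroʳ _))) i

  sum-nonneg : ∀ {n} {x : Vector ℝ n} → (∀ i → 0# ≤ x i) → 0# ≤ sum x
  sum-nonneg {zero}  0≤x = ≤-refl
  sum-nonneg {suc n} 0≤x = +-nonneg (0≤x zero) (sum-nonneg (0≤x ∘ suc))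

  -- The truncated exponential series and Euler's number

  ^-nonneg : ∀ {s} → 0# ≤ s → ∀ k → 0# ≤ s ^ k
  ^-nonneg 0≤s zero    = 0≤1
  ^-nonneg 0≤s (suc k) = *-nonneg 0≤s (^-nonneg 0≤s k)

  ^-≤1 : ∀ {s} → 0# ≤ s → s ≤ 1# → ∀ k → s ^ k ≤ 1#
  ^-≤1 0≤s s≤1 zero    = ≤-refl
  ^-≤1 {s} 0≤s s≤1 (suc k) = begin
    s * s ^ k   ≤⟨ *-monoʳ-≤ (^-nonneg 0≤s k) s≤1 ⟩
    1# * s ^ k  ≈⟨ *-identityˡ _ ⟩
    s ^ k       ≤⟨ ^-≤1 0≤s s≤1 k ⟩
    1#          ∎
    where open ≤-Reasoning

  -- The left side consists of the first two terms of the binomial expansion of the right; the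
  -- others are nonnegative. Multiplying the induction hypothesis by a + s leaves over exactly (k +
  -- 1) a² sᵏ.
  bernoulli : ∀ {s a} → 0# ≤ s → 0# ≤ a → ∀ k →
              s ^ suc k + fromℕ (suc k) * (a * s ^ k) ≤ (a + s) ^ suc k
  bernoulli {s} {a} 0≤s 0≤a zero = ≤-reflexive
    (solve 2 (λ s a → s :* :1 :+ (:1 :+ :0) :* (a :* :1) := (a :+ s) :* :1) ≈-refl s a)
  bernoulli {s} {a} 0≤s 0≤a (suc k) = ≤-trans
    (≤-by {d = fromℕ (suc k) * (a * (a * s ^ k))} (*-nonneg (fromℕ-nonneg (suc k)) (*-nonneg 0≤a (*-nonneg 0≤a (^-nonneg 0≤s k))))
      (solve 4 (λ s a m p →
        (a :+ s) :* (s :* p :+ m :* (a :* p)) :- (s :* (s :* p) :+ (:1 :+ m) :* (a :* (s :* p))) := m :* (a :* (a :* p)))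
        ≈-refl s a (fromℕ (suc k)) (s ^ k)))
    (*-monoˡ-≤ (+-nonneg 0≤a 0≤s) (bernoulli 0≤s 0≤a k))

  u : ℕ → ℝ
  u k = fromℕ (k !) ⁻¹

  fromℕ-!-pos : ∀ k → 0# < fromℕ (k !)
  fromℕ-!-pos k = <-≤-trans (fromℕ-pos 0) (fromℕ-mono-≤ (ℕ.1≤n! k))

  u-inverse : ∀ k → fromℕ (k !) * u k ≈ 1#
  u-inverse k = pos-inverse (fromℕ-!-pos k)

  u-nonneg : ∀ k → 0# ≤ u k
  u-nonneg k = <⇒≤ (⁻¹-pos (fromℕ-!-pos k))

  u₀≈1 : u 0 ≈ 1#
  u₀≈1 = inverse-unique (u-inverse 0) (solve 0 ((:1 :+ :0) :* :1 := :1) ≈-refl)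

  u-suc : ∀ k → fromℕ (suc k) * u (suc k) ≈ u k
  u-suc k = inverse-unique (begin
      fromℕ (k !) * (fromℕ (suc k) * u (suc k))  ≈⟨ solve 3 (λ x y z → x :* (y :* z) := (y :* x) :* z) ≈-refl (fromℕ (k !)) (fromℕ (suc k)) (u (suc k)) ⟩
      (fromℕ (suc k) * fromℕ (k !)) * u (suc k)  ≈⟨ *-congʳ (×1-homo-* (suc k) (k !)) ⟨
      fromℕ (suc k !) * u (suc k)                ≈⟨ u-inverse (suc k) ⟩
      1#                                         ∎)
    (u-inverse k)
    where open import Relation.Binary.Reasoning.Setoid setoid

  term : ℝ → ℕ → ℝ
  term s k = s ^ k * u k

  -- `bernoulli` divided by (k + 1)!. It compares one term of (1 + a) exp s, graded by total degree
  -- in `s` and `a`, with that of exp (a + s).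
  term-+ : ∀ {s a} → 0# ≤ s → 0# ≤ a → ∀ k → term s (suc k) + a * term s k ≤ term (a + s) (suc k)
  term-+ {s} {a} 0≤s 0≤a k = begin
    s ^ suc k * u (suc k) + a * (s ^ k * u k)                            ≈⟨ +-congˡ (*-congˡ (*-congˡ (u-suc k))) ⟨
    s ^ suc k * u (suc k) + a * (s ^ k * (fromℕ (suc k) * u (suc k)))    ≈⟨ solve 5 (λ P p a m v → P :* v :+ a :* (p :* (m :* v)) := (P :+ m :* (a :* p)) :* v)
                                                                              ≈-refl (s ^ suc k) (s ^ k) a (fromℕ (suc k)) (u (suc k)) ⟩
    (s ^ suc k + fromℕ (suc k) * (a * s ^ k)) * u (suc k)                ≤⟨ *-monoʳ-≤ (u-nonneg (suc k)) (bernoulli 0≤s 0≤a k) ⟩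
    (a + s) ^ suc k * u (suc k)                                          ∎
    where open ≤-Reasoning

  -- A truncated form of (1 + a) exp s ≤ exp (a + s). The sum multiplied by `a` is one term shorter
  -- because the factor `a` raises the degree by one.
  exp-+ : ∀ {s a} → 0# ≤ s → 0# ≤ a → ∀ n →
          partial (term s) (suc n) + a * partial (term s) n ≤ partial (term (a + s)) (suc n)
  exp-+ {s} {a} 0≤s 0≤a zero = ≤-reflexive
    (solve 2 (λ t a → (t :+ :0) :+ a :* :0 := t :+ :0) ≈-refl (1# * u 0) a)
  exp-+ {s} {a} 0≤s 0≤a (suc n) = begin
    partial (term s) (suc (suc n)) + a * partial (term s) (suc n)
      ≈⟨ +-cong (partial-suc (term s) (suc n)) (*-congˡ (partial-suc (term s) n)) ⟩
    (partial (term s) (suc n) + term s (suc n)) + a * (partial (term s) n + term s n)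
      ≈⟨ solve 5 (λ P T p t a → (P :+ T) :+ a :* (p :+ t) := (P :+ a :* p) :+ (T :+ a :* t))
           ≈-refl (partial (term s) (suc n)) (term s (suc n)) (partial (term s) n) (term s n) a ⟩
    (partial (term s) (suc n) + a * partial (term s) n) + (term s (suc n) + a * term s n)
      ≤⟨ +-mono-≤ (exp-+ 0≤s 0≤a n) (term-+ 0≤s 0≤a n) ⟩
    partial (term (a + s)) (suc n) + term (a + s) (suc n)
      ≈⟨ partial-suc (term (a + s)) (suc n) ⟨
    partial (term (a + s)) (suc (suc n)) ∎
    where open ≤-Reasoning

  -- Each factor 1 + aᵢ is absorbed by `exp-+` at the price of one more term of the series, so `n`
  -- factors are covered by degree `n`.
  product-1+≤exp-sum : ∀ {n} {a : Vector ℝ n} → (∀ i → 0# ≤ a i) →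
                       product (λ i → 1# + a i) ≤ partial (term (sum a)) (suc n)
  product-1+≤exp-sum {zero} _ = ≤-reflexive (≈-trans (≈-sym u₀≈1)
    (solve 1 (λ u → u := :1 :* u :+ :0) ≈-refl (u 0)))
  product-1+≤exp-sum {suc n} {a} 0≤a = begin
    (1# + a zero) * product (λ i → 1# + a (suc i))    ≤⟨ *-monoˡ-≤ (+-nonneg 0≤1 (0≤a zero)) (product-1+≤exp-sum (0≤a ∘ suc)) ⟩
    (1# + a zero) * E (suc n)                         ≈⟨ solve 2 (λ a e → (:1 :+ a) :* e := e :+ a :* e) ≈-refl (a zero) (E (suc n)) ⟩
    E (suc n) + a zero * E (suc n)                    ≤⟨ +-mono-≤ (partial-mono (λ k → *-nonneg (^-nonneg 0≤s k) (u-nonneg k)) (ℕ.n≤1+n (suc n))) ≤-refl ⟩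
    E (suc (suc n)) + a zero * E (suc n)              ≤⟨ exp-+ 0≤s (0≤a zero) (suc n) ⟩
    partial (term (a zero + sum (a ∘ suc))) (suc (suc n))  ∎
    where
    open ≤-Reasoning
    0≤s = sum-nonneg (0≤a ∘ suc)
    E = partial (term (sum (a ∘ suc)))

  -- Convexity of exp on [0, 1], with s moved to the left so that nothing is
  -- subtracted from the partial sums.
  exp-convex : ∀ {s} → 0# ≤ s → s ≤ 1# → ∀ n →
               partial (term s) (suc n) + s ≤ 1# + s * partial u (suc n)
  exp-convex {s} 0≤s s≤1 zero = ≤-reflexive (begin
    (1# * u 0 + 0#) + s   ≈⟨ +-congʳ (+-congʳ (*-congˡ u₀≈1)) ⟩
    (1# * 1# + 0#) + s    ≈⟨ solve 1 (λ s → (:1 :* :1 :+ :0) :+ s := :1 :+ s :* (:1 :+ :0)) ≈-refl s ⟩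
    1# + s * (1# + 0#)    ≈⟨ +-congˡ (*-congˡ (+-congʳ u₀≈1)) ⟨
    1# + s * (u 0 + 0#)   ∎)
    where open import Relation.Binary.Reasoning.Setoid setoid
  exp-convex {s} 0≤s s≤1 (suc n) = begin
    partial (term s) (suc (suc n)) + s
      ≈⟨ +-congʳ (partial-suc (term s) (suc n)) ⟩
    (partial (term s) (suc n) + s * s ^ n * v) + s
      ≈⟨ solve 4 (λ E s p v → (E :+ s :* p :* v) :+ s := (E :+ s) :+ p :* (s :* v)) ≈-refl (partial (term s) (suc n)) s (s ^ n) v ⟩
    (partial (term s) (suc n) + s) + s ^ n * (s * v)
      -- Convexity is checked term by term: a power of `s` with positive exponent is at most `s` on
      -- [0, 1].
      ≤⟨ +-mono-≤ (exp-convex 0≤s s≤1 n) (*-monoʳ-≤ (*-nonneg 0≤s (u-nonneg (suc n))) (^-≤1 0≤s s≤1 n)) ⟩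
    (1# + s * partial u (suc n)) + 1# * (s * v)
      ≈⟨ solve 3 (λ s p v → (:1 :+ s :* p) :+ :1 :* (s :* v) := :1 :+ s :* (p :+ v)) ≈-refl s (partial u (suc n)) v ⟩
    1# + s * (partial u (suc n) + v)
      ≈⟨ +-congˡ (*-congˡ (partial-suc u (suc n))) ⟨
    1# + s * partial u (suc (suc n)) ∎
    where
    open ≤-Reasoning
    v = u (suc n)

  module _ {e : ℝ} (e-euler : IsEuler e) where

    partial-u≤e : ∀ n → partial u n ≤ e
    partial-u≤e = partial≤HasSum u-nonneg e-euler

    1<e : 1# < e
    1<e = <-≤-trans (<-by 0<1 (begin
        partial u 2 - 1#        ≈⟨ +-congʳ (+-cong u₀≈1 (+-congʳ (inverse-unique (u-inverse 1) (solve 0 ((:1 :+ :0) :* :1 := :1) ≈-refl)))) ⟩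
        (1# + (1# + 0#)) - 1#   ≈⟨ solve 0 ((:1 :+ (:1 :+ :0)) :- :1 := :1) ≈-refl ⟩
        1#                      ∎))
      (partial-u≤e 2)
      where open import Relation.Binary.Reasoning.Setoid setoid

    0<e : 0# < e
    0<e = ≤-<-trans 0≤1 1<e

    0<e⁻¹ : 0# < e ⁻¹
    0<e⁻¹ = ⁻¹-pos 0<e

    e⁻¹<1 : e ⁻¹ < 1#
    e⁻¹<1 = begin-strict
      e ⁻¹       ≈⟨ *-identityˡ _ ⟨
      1# * e ⁻¹  <⟨ *-monoʳ-< 0<e⁻¹ 1<e ⟩
      e * e ⁻¹   ≈⟨ pos-inverse 0<e ⟩
      1#         ∎
      where open ≤-Reasoning

    1≤sum : ∀ {n} {a : Vector ℝ n} → (∀ i → 0# ≤ a i) → e ≤ product (λ i → 1# + a i) → 1# ≤ sum a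
    1≤sum {n} {a} 0≤a e≤P = ≮⇒≥ λ s<1 → <⇒≱ (*-pos (gap< 1<e) (gap< s<1))
      (≤-by (gap (e+s≤1+se s<1))
        (solve 2 (λ e s → :0 :- (e :- :1) :* (:1 :- s) := (:1 :+ s :* e) :- (e :+ s)) ≈-refl e s))
      where
      open ≤-Reasoning
      s = sum a
      e+s≤1+se : s < 1# → e + s ≤ 1# + s * e
      e+s≤1+se s<1 = begin
        e + s                            ≤⟨ +-mono-≤ (≤-trans e≤P (product-1+≤exp-sum 0≤a)) ≤-refl ⟩
        partial (term s) (suc n) + s     ≤⟨ exp-convex (sum-nonneg 0≤a) (<⇒≤ s<1) n ⟩
        1# + s * partial u (suc n)       ≤⟨ +-mono-≤ ≤-refl (*-monoˡ-≤ (sum-nonneg 0≤a) (partial-u≤e (suc n))) ⟩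
        1# + s * e                       ∎

  -- Measurable sets and probability measures

  module MeasurableSets {Ω : Set} (𝓕 : σ-Algebra Ω) where

    open σ-Algebra 𝓕 renaming (resp-≐ to m-≐; univ to m-U; compl to m-∁; union to m-⋃)

    abstract
      m-∅ : Measurable ∅
      m-∅ = m-≐ ((λ f → f tt) , λ ()) (m-∁ m-U)

    pair : Pred Ω 0ℓ → Pred Ω 0ℓ → ℕ → Pred Ω 0ℓ
    pair A B zero          = A
    pair A B (suc zero)    = B
    pair A B (suc (suc k)) = ∅

    m-pair : ∀ {A B} → Measurable A → Measurable B → ∀ k → Measurable (pair A B k)
    m-pair a b zero          = a
    m-pair a b (suc zero)    = b
    m-pair a b (suc (suc k)) = m-∅

    ⋃-pair : ∀ {A B} → ⋃ ℕ (pair A B) ≐ A ∪ B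
    ⋃-pair = (λ { (zero , x) → inj₁ x ; (suc zero , x) → inj₂ x })
           , (λ { (inj₁ x) → 0 , x ; (inj₂ x) → 1 , x })

    abstract
      m-∪ : ∀ {A B} → Measurable A → Measurable B → Measurable (A ∪ B)
      m-∪ a b = m-≐ ⋃-pair (m-⋃ (m-pair a b))

      m-∩ : ∀ {A B} → Measurable A → Measurable B → Measurable (A ∩ B)
      m-∩ a b = m-≐
        ((λ f → decidable-stable em (f ∘ inj₁) , decidable-stable em (f ∘ inj₂))
        , (λ { (x , y) (inj₁ x̄) → x̄ x ; (x , y) (inj₂ ȳ) → ȳ y }))
        (m-∁ (m-∪ (m-∁ a) (m-∁ b)))

      -- As `Q` does not depend on ω, excluded middle makes this event either `A` or everything. It
      -- handles the condition that one time precedes another in the stopping event.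
      m-→ : ∀ {Q : Set} {A} → Measurable A → Measurable (λ ω → Q → A ω)
      m-→ {Q} a = case em {Q} of λ where
        (yes q) → m-≐ ((λ x _ → x) , λ f → f q) a
        (no ¬q) → m-≐ ((λ _ q → ⊥-elim (¬q q)) , λ _ → tt) m-U

      m-∀ : ∀ {n} {A : Fin n → Pred Ω 0ℓ} → (∀ i → Measurable (A i)) → Measurable (λ ω → ∀ i → A i ω)
      m-∀ {zero}  a = m-≐ ((λ _ ()) , λ _ → tt) m-U
      m-∀ {suc n} a = m-≐ ((λ { (x , f) zero → x ; (x , f) (suc i) → f i }) , λ f → f zero , f ∘ suc)
        (m-∩ (a zero) (m-∀ (a ∘ suc)))

      m-∃ : ∀ {n} {A : Fin n → Pred Ω 0ℓ} → (∀ i → Measurable (A i)) → Measurable (λ ω → ∃[ i ] A i ω)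
      m-∃ {zero}  a = m-≐ ((λ ()) , λ ()) m-∅
      m-∃ {suc n} a = m-≐ ((λ { (inj₁ x) → zero , x ; (inj₂ (i , x)) → suc i , x })
                             , λ { (zero , x) → inj₁ x ; (suc i , x) → inj₂ (i , x) })
        (m-∪ (a zero) (m-∃ (a ∘ suc)))

  module Measure {Ω : Set} (𝓕 : σ-Algebra Ω)
    (P : ProbabilityMeasure 𝓕) where

    open σ-Algebra 𝓕 renaming (resp-≐ to m-≐; univ to m-U; compl to m-∁; union to m-⋃)
    open ProbabilityMeasure
    open MeasurableSets 𝓕

    -- Countably many copies of the empty set are disjoint and have empty union, so its probability
    -- p satisfies p + p ≤ p.
    Pr-∅ : Pr P m-∅ ≈ 0#
    Pr-∅ = antisym (≤-by (gap p+p≤p) (solve 1 (λ p → :0 :- p := p :- (p :+ (p :+ :0))) ≈-refl (Pr P m-∅))) (Pr-nonneg P m-∅)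
      where
      p+p≤p : Pr P m-∅ + (Pr P m-∅ + 0#) ≤ Pr P m-∅
      p+p≤p = ≤-respʳ-≈ (Pr-cong P (m-⋃ (λ _ → m-∅)) m-∅ ((λ ()) , λ ()))
        (partial≤HasSum (λ _ → Pr-nonneg P m-∅) (σ-additive P (λ _ → m-∅) λ _ ()) 2)

    -- Finite additivity: padded with empty sets, the pair gives a series whose partial sums are
    -- constant from the second on. `C` carries its own measurability proof, since `Pr` is applied
    -- to proofs and the one at hand rarely has the form of a union.
    Pr-⊎ : ∀ {A B C} (a : Measurable A) (b : Measurable B) (c : Measurable C) →
           A ⊥ B → A ∪ B ≐ C → Pr P c ≈ Pr P a + Pr P b
    Pr-⊎ {A} {B} a b c A⊥B (to , from) = ≈-trans
      (Pr-cong P c (m-⋃ (m-pair a b)) (proj₂ ⋃-pair ∘ from , to ∘ proj₁ ⋃-pair))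
      (eventually-constant⇒limit {a = λ k → Pr P (m-pair a b k)} 2 (λ n → ≈-trans (+-congˡ (+-congˡ (zeros n))) (+-congˡ (+-identityʳ _)))
        (σ-additive P (m-pair a b) disjoint))
      where
      zeros : ∀ n → partial (λ k → Pr P (m-pair a b (suc (suc k)))) n ≈ 0#
      zeros zero    = ≈-refl
      zeros (suc n) = ≈-trans (+-cong Pr-∅ (zeros n)) (+-identityˡ 0#)
      disjoint : ∀ {j k} → j ≢ k → pair A B j ⊥ pair A B k
      disjoint {zero}        {zero}        j≢k _       = j≢k ≡.refl
      disjoint {zero}        {suc zero}    _   (x , y) = A⊥B (x , y)
      disjoint {suc zero}    {zero}        _   (y , x) = A⊥B (x , y)
      disjoint {suc zero}    {suc zero}    j≢k _       = j≢k ≡.refl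
      disjoint {zero}        {suc (suc k)} _   (_ , ())
      disjoint {suc zero}    {suc (suc k)} _   (_ , ())
      disjoint {suc (suc j)}               _   (() , _)

    _∖_ : ∀ {A B} → Measurable A → Measurable B → Measurable (A ∩ ∁ B)
    a ∖ b = m-∩ a (m-∁ b)

    Pr-∖ : ∀ {A B} (a : Measurable A) (b : Measurable B) → B ⊆ A → Pr P a ≈ Pr P b + Pr P (a ∖ b)
    Pr-∖ a b B⊆A = Pr-⊎ b (a ∖ b) a (λ (y , _ , ȳ) → ȳ y)
      ( (λ { (inj₁ y) → B⊆A y ; (inj₂ (x , _)) → x })
      , (λ x → case em of λ { (yes y) → inj₁ y ; (no ȳ) → inj₂ (x , ȳ) }))

    Pr-mono : ∀ {A B} (a : Measurable A) (b : Measurable B) → A ⊆ B → Pr P a ≤ Pr P b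
    Pr-mono a b A⊆B = ≤-by (Pr-nonneg P (b ∖ a)) (≈-trans (+-congʳ (Pr-∖ b a A⊆B))
      (solve 2 (λ x d → (x :+ d) :- x := d) ≈-refl (Pr P a) (Pr P (b ∖ a))))

    Pr-∪-≤ : ∀ {A B C} (a : Measurable A) (b : Measurable B) (c : Measurable C) →
             C ⊆ A ∪ B → Pr P c ≤ Pr P a + Pr P b
    Pr-∪-≤ {A} {B} {C} a b c C⊆A∪B = ≤-trans
      (Pr-mono c (m-∪ a b) C⊆A∪B)
      (≤-trans (≤-reflexive (Pr-∖ (m-∪ a b) a inj₁))
        (+-mono-≤ ≤-refl (Pr-mono (m-∪ a b ∖ a) b λ { (inj₁ x , x̄) → ⊥-elim (x̄ x) ; (inj₂ y , _) → y })))

    Pr-∈[0,1] : ∀ {A} (a : Measurable A) → UnitInterval (Pr P a)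
    Pr-∈[0,1] a = Pr-nonneg P a , ≤-respʳ-≈ (Pr-univ P) (Pr-mono a m-U _)

    Pr-∁ : ∀ {A B} (a : Measurable A) (b : Measurable B) → B ≐ ∁ A → Pr P b ≈ 1# - Pr P a
    Pr-∁ a b (to , from) = begin
      Pr P b                 ≈⟨ solve 2 (λ x y → y := (x :+ y) :- x) ≈-refl (Pr P a) (Pr P b) ⟩
      (Pr P a + Pr P b) - Pr P a ≈⟨ +-congʳ (Pr-⊎ a b m-U (λ (x , y) → to y x)
                                ((λ _ → tt) , λ _ → case em of λ { (yes x) → inj₁ x ; (no x̄) → inj₂ (from x̄) })) ⟨
      Pr P m-U - Pr P a       ≈⟨ +-congʳ (Pr-univ P) ⟩
      1# - Pr P a            ∎
      where open import Relation.Binary.Reasoning.Setoid setoid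

    -- Removing the first event from `B` leaves the others inside, by disjointness, and the
    -- induction continues with the difference.
    sum-Pr≤Pr : ∀ {n} {A : Fin n → Pred Ω 0ℓ} {B} (a : ∀ i → Measurable (A i)) (b : Measurable B) →
                (∀ {i j} → i ≢ j → A i ⊥ A j) → (∀ i → A i ⊆ B) → sum (λ i → Pr P (a i)) ≤ Pr P b
    sum-Pr≤Pr {zero}  a b disjoint A⊆B = Pr-nonneg P b
    sum-Pr≤Pr {suc n} a b disjoint A⊆B = ≤-trans
      (+-mono-≤ ≤-refl (sum-Pr≤Pr (a ∘ suc) (b ∖ a zero)
        (λ i≢j → disjoint (i≢j ∘ Fin.suc-injective))
        (λ i x → A⊆B (suc i) x , λ x₀ → disjoint (λ ()) (x₀ , x))))
      (≤-reflexive (≈-sym (Pr-∖ b (a zero) (A⊆B zero))))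

    module _ {A : ℕ → Pred Ω 0ℓ} (a : ∀ k → Measurable (A k)) (A-dec : ∀ k → A (suc k) ⊆ A k)
             {N : Pred Ω 0ℓ} (m-N : Measurable N) (Pr-N : Pr P m-N ≈ 0#) (⋂A⊆N : ∀ {ω} → (∀ k → A k ω) → N ω) where

      private
        shell : ∀ k → Measurable (A k ∩ ∁ (A (suc k)))
        shell k = a k ∖ a (suc k)

        A-anti : ∀ {j k} → j ℕ.≤ k → A k ⊆ A j
        A-anti {k = zero}  ℕ.z≤n x = x
        A-anti {k = suc k} ℕ.z≤n x = A-anti {k = k} ℕ.z≤n (A-dec k x)
        A-anti {suc j} {suc k} j≤k x = case ℕ.m≤n⇒m<n∨m≡n j≤k of λ where
          (inj₁ (ℕ.s≤s j<k)) → A-anti j<k (A-dec k x)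
          (inj₂ ≡.refl)      → x

        shell-disjoint : ∀ {j k} → j ≢ k → (A j ∩ ∁ (A (suc j))) ⊥ (A k ∩ ∁ (A (suc k)))
        shell-disjoint {j} {k} j≢k ((x , x̄) , (y , ȳ)) = case ℕ.<-cmp j k of λ where
          (tri< j<k _ _) → x̄ (A-anti j<k y)
          (tri≈ _ j≡k _) → j≢k j≡k
          (tri> _ _ k<j) → ȳ (A-anti k<j x)

        A₀⊆ : A 0 ⊆ N ∪ ⋃ ℕ (λ k → A k ∩ ∁ (A (suc k)))
        A₀⊆ {ω} x₀ = case em {∃[ k ] (A k ω × ¬ A (suc k) ω)} of λ
          { (yes x) → inj₂ x
          ; (no ¬x) → inj₁ (⋂A⊆N (stays ¬x))
          }
          where
          stays : ¬ (∃[ k ] (A k ω × ¬ A (suc k) ω)) → ∀ k → A k ω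
          stays ¬x zero    = x₀
          stays ¬x (suc k) = decidable-stable em λ x̄ → ¬x (k , stays ¬x k , x̄)

        -- Pr (a n) is the tail of a convergent telescoping series.
        partial-shell : ∀ n → partial (λ k → Pr P (shell k)) n ≈ Pr P (a 0) - Pr P (a n)
        partial-shell zero    = ≈-sym (-‿inverseʳ _)
        partial-shell (suc n) = begin
          partial p (suc n)                          ≈⟨ partial-suc p n ⟩
          partial p n + p n                          ≈⟨ +-congʳ (partial-shell n) ⟩
          (Pr P (a 0) - Pr P (a n)) + p n                ≈⟨ +-congʳ (+-congˡ (-‿cong (Pr-∖ (a n) (a (suc n)) (A-dec n)))) ⟩
          (Pr P (a 0) - (Pr P (a (suc n)) + p n)) + p n  ≈⟨ solve 3 (λ x y z → (x :- (y :+ z)) :+ z := x :- y) ≈-refl (Pr P (a 0)) (Pr P (a (suc n))) (p n) ⟩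
          Pr P (a 0) - Pr P (a (suc n))                  ∎
          where
          open import Relation.Binary.Reasoning.Setoid setoid
          p : ℕ → ℝ
          p k = Pr P (shell k)

      abstract
        -- Continuity from above. A point of `A 0` either leaves the sequence at some stage, hence
        -- lies in a shell, or stays forever and lies in the null set `N`. So the shells carry the
        -- whole probability of `A 0`, and what their partial sums miss is `Pr (a k)`. In the uses
        -- below, `N` is empty for the tails at infinity and a single point for shrinking intervals.
        Pr-vanishes : ∀ {ε} → 0# < ε → ∃[ K ] (∀ k → K ℕ.≤ k → Pr P (a k) < ε)
        Pr-vanishes {ε} 0<ε =
          let K , close = σ-additive P shell shell-disjoint 0<ε
          in K , λ k K≤k → <-by (gap< (≤-<-trans a₀≤s
               (<-≤-trans (<-by (gap< (proj₁ (close k K≤k))) (solve 3 (λ s p ε → (p :+ ε) :- s := p :- (s :- ε)) ≈-refl _ _ ε))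
                 (≤-reflexive (+-congʳ (partial-shell k))))))
               (solve 3 (λ x y ε → ε :- y := (x :- y :+ ε) :- x) ≈-refl (Pr P (a 0)) (Pr P (a k)) ε)
          where
          a₀≤s : Pr P (a 0) ≤ Pr P (m-⋃ shell)
          a₀≤s = ≤-trans (Pr-∪-≤ m-N (m-⋃ shell) (a 0) A₀⊆)
            (≤-reflexive (≈-trans (+-congʳ Pr-N) (+-identityˡ _)))

  -- An intermediate value theorem for monotone functions

  module _ (G : ℝ → ℝ) (G-mono : ∀ {s t} → s ≤ t → G s ≤ G t)
    (G-continuous : ∀ t {ε} → 0# < ε → ∃[ k ] G (t + δ k) < G (t - δ k) + ε)
    (G-top : ∀ {ε} → 0# < ε → ∃[ k ] 1# < G (fromℕ k) + ε)
    (G-bottom : ∀ {ε} → 0# < ε → ∃[ k ] G (- fromℕ k) < ε)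
    where

    -- Take for t the supremum of the points where G ≤ c. By monotonicity `G-continuous` controls
    -- `G` on both sides of t at once: if G t > c, some t - δ k would still be an upper bound; if G
    -- t < c, some t + δ k would still belong to the set.
    intermediate-value : ∀ {c} → 0# < c → c < 1# → ∃[ t ] G t ≈ c
    intermediate-value {c} 0<c c<1 =
      let lo , Glo<c = G-bottom 0<c
          hi , 1<Ghi+1-c = G-top (gap< c<1)
          c<Ghi = <-by (gap< 1<Ghi+1-c) (solve 2 (λ g c → g :- c := g :+ (:1 :- c) :- :1) ≈-refl (G (fromℕ hi)) c)
          t , upper , least = sup S (- fromℕ lo , <⇒≤ Glo<c) (fromℕ hi , G>c⇒upper c<Ghi)
      in t , antisym (≮⇒≥ (G≯c upper least)) (≮⇒≥ (G≮c upper))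
      where
      S : Pred ℝ 0ℓ
      S t = G t ≤ c

      G>c⇒upper : ∀ {t} → c < G t → UpperBound S t
      G>c⇒upper c<Gt Gs≤c = ≮⇒≥ λ t<s → <⇒≱ c<Gt (≤-trans (G-mono (<⇒≤ t<s)) Gs≤c)

      module _ {t : ℝ} (upper : UpperBound S t) where

        t-δ≤t : ∀ k → t - δ k ≤ t
        t-δ≤t k = ≤-by (<⇒≤ (δ-pos k)) (solve 2 (λ t d → t :- (t :- d) := d) ≈-refl t (δ k))

        t<t+δ : ∀ k → t < t + δ k
        t<t+δ k = <-by (δ-pos k) (solve 2 (λ t d → (t :+ d) :- t := d) ≈-refl t (δ k))

        G≯c : (∀ {v} → UpperBound S v → t ≤ v) → ¬ c < G t
        G≯c least c<Gt =
          let k , close = G-continuous t (gap< c<Gt)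
              c<G[t-δ] = <-by (gap< (≤-<-trans (G-mono (<⇒≤ (t<t+δ k))) close))
                (solve 3 (λ g g′ c → g′ :- c := (g′ :+ (g :- c)) :- g) ≈-refl (G t) (G (t - δ k)) c)
          in <⇒≱ (δ-pos k) (≤-by (gap (least (G>c⇒upper c<G[t-δ])))
               (solve 2 (λ t d → :0 :- d := (t :- d) :- t) ≈-refl t (δ k)))

        G≮c : ¬ G t < c
        G≮c Gt<c =
          let k , close = G-continuous t (gap< Gt<c)
              G[t+δ]≤c = ≤-trans (<⇒≤ close) (≤-by (gap (G-mono (t-δ≤t k)))
                (solve 3 (λ g g′ c → c :- (g′ :+ (c :- g)) := g :- g′) ≈-refl (G t) (G (t - δ k)) c))
          in <⇒≱ (t<t+δ k) (upper G[t+δ]≤c)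

  -- Borel sets and existence of the threshold

  module BorelSets where

    open MeasurableSets Borel

    Above Below : ℝ → Pred ℝ 0ℓ
    Above t x = t < x
    Below t x = x ≤ t

    Borelian : Pred ℝ 0ℓ → Set₁
    Borelian = σ-Algebra.Measurable Borel

    abstract
      borel-above : ∀ t → Borelian (Above t)
      borel-above t = basic λ {x} t<x → x - t , gap< t<x , λ (lower , _) →
        ≤-<-trans (≤-reflexive (solve 2 (λ t x → t := x :- (x :- t)) ≈-refl t x)) lower

      borel-below : ∀ t → Borelian (Below t)
      borel-below t = resp-≐ (≮⇒≥ , λ x≤t t<x → <⇒≱ t<x x≤t) (compl (borel-above t))

      borel-strictly-below : ∀ t → Borelian (_< t)
      borel-strictly-below t = basic λ {x} x<t → t - x , gap< x<t , λ (_ , upper) →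
        <-≤-trans upper (≤-reflexive (solve 2 (λ t x → x :+ (t :- x) := t) ≈-refl t x))

      borel-singleton : ∀ t → Borelian (_≈ t)
      borel-singleton t = resp-≐
        ((λ (x≤t , x≮t) → antisym x≤t (≮⇒≥ x≮t)) , λ x≈t → ≤-reflexive x≈t , λ x<t → proj₂ x<t x≈t)
        (m-∩ (borel-below t) (compl (borel-strictly-below t)))

  module Threshold {n : ℕ} (I : Instance (suc n)) where

    open BorelSets
    open MeasurableSets Borel
    open Instance I
    open ProbabilityMeasure
    module D (i : Fin (suc n)) where
      open Measure Borel (dist i) public

    cdf : ℝ → Vector ℝ (suc n)
    cdf t i = Pr (dist i) (borel-below t)

    cdf-∈[0,1] : ∀ t i → UnitInterval (cdf t i)
    cdf-∈[0,1] t i = D.Pr-∈[0,1] i (borel-below t)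

    product-cdf-mono : ∀ {s t} → s ≤ t → product (cdf s) ≤ product (cdf t)
    product-cdf-mono {s} {t} s≤t = product-mono-≤ (proj₁ ∘ cdf-∈[0,1] s) (proj₁ ∘ cdf-∈[0,1] t)
      λ i → D.Pr-mono i (borel-below s) (borel-below t) λ x≤s → ≤-trans x≤s s≤t

    module _ {A : ℕ → Pred ℝ 0ℓ} (a : ∀ k → Borelian (A k)) (A-dec : ∀ k → A (suc k) ⊆ A k)
             {N : Pred ℝ 0ℓ} (m-N : Borelian N) (Pr-N : ∀ i → Pr (dist i) m-N ≈ 0#)
             (⋂A⊆N : ∀ {x} → (∀ k → A k x) → N x)
             {x y : ℕ → Vector ℝ (suc n)} (x∈ : ∀ k i → UnitInterval (x k i)) (y∈ : ∀ k i → UnitInterval (y k i))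
             (y≤x+a : ∀ k i → y k i ≤ x k i + Pr (dist i) (a k)) where

      abstract
        -- The common source of the continuity of ∏ qᵢ and of its limits at both infinities: factors
        -- may differ by the probability of an event that shrinks to a null set. `uniform-bound`
        -- provides one index that works for all distributions.
        products-close : ∀ {ε} → 0# < ε → ∃[ k ] product (y k) < product (x k) + ε
        products-close {ε} 0<ε =
          let K , Pr<η = uniform-bound (λ i → D.Pr-vanishes i a A-dec m-N (Pr-N i) ⋂A⊆N 0<η)
          in K , (begin-strict
            product (y K)                            ≤⟨ product-perturb (<⇒≤ 0<η) (x∈ K) (y∈ K)
                                                          (λ i → ≤-trans (y≤x+a K i) (+-mono-≤ ≤-refl (<⇒≤ (Pr<η i K ℕ.≤-refl)))) ⟩
            product (x K) + fromℕ (suc n) * η        <⟨ <-by 0<η (solve 3 (λ P m η → (P :+ (:1 :+ m) :* η) :- (P :+ m :* η) := η)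
                                                          ≈-refl (product (x K)) (fromℕ (suc n)) η) ⟩
            product (x K) + fromℕ (suc (suc n)) * η  ≈⟨ +-congˡ (≈-trans
                                                          (solve 3 (λ m ε d → m :* (ε :* d) := ε :* (m :* d)) ≈-refl (fromℕ (suc (suc n))) ε (δ (suc n)))
                                                          (≈-trans (*-congˡ (δ-inverse (suc n))) (*-identityʳ ε))) ⟩
            product (x K) + ε                        ∎)
          where
          open ≤-Reasoning
          η : ℝ
          -- This is ε/(n + 2), whereas there are n + 1 factors; the spare `η` makes the final
          -- inequality strict.
          η = ε * δ (suc n)
          0<η : 0# < η
          0<η = *-pos 0<ε (δ-pos (suc n))

    below-or-above : ∀ t x → x ≤ t ⊎ t < x
    below-or-above t x = case em of λ { (yes x≤t) → inj₁ x≤t ; (no x≰t) → inj₂ (≰⇒> x≰t) }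

    -- The limits of the distribution functions at the two infinities, as vectors to which
    -- `products-close` applies.
    ones zeros : Vector ℝ (suc n)
    ones  _ = 1#
    zeros _ = 0#

    module _ (b : ℕ → ℝ) (b-inc : ∀ k → b k ≤ b (suc k)) (b-unbounded : ∀ x → ∃[ k ] x < b k) where

      ones-close : ∀ {ε} → 0# < ε → ∃[ k ] product ones < product (cdf (b k)) + ε
      ones-close = products-close
        (λ k → borel-above (b k)) (λ k → ≤-<-trans (b-inc k)) m-∅ (λ i → D.Pr-∅ i)
        (λ {x} above → let k , x<b = b-unbounded x in <⇒≱ x<b (<⇒≤ (above k)))
        (λ k → cdf-∈[0,1] (b k)) (λ _ _ → 0≤1 , ≤-refl)
        (λ k i → ≤-respˡ-≈ (Pr-univ (dist i))
          (D.Pr-∪-≤ i (borel-below (b k)) (borel-above (b k)) univ λ {x} _ → below-or-above (b k) x))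

    module _ (b : ℕ → ℝ) (b-dec : ∀ k → b (suc k) ≤ b k) (b-unbounded : ∀ x → ∃[ k ] b k < x) where

      zeros-close : ∀ {ε} → 0# < ε → ∃[ k ] product (cdf (b k)) < product zeros + ε
      zeros-close = products-close
        (λ k → borel-below (b k)) (λ k x≤ → ≤-trans x≤ (b-dec k)) m-∅ (λ i → D.Pr-∅ i)
        (λ {x} below → let k , b<x = b-unbounded x in <⇒≱ b<x (below k))
        (λ _ _ → ≤-refl , 0≤1) (λ k → cdf-∈[0,1] (b k))
        (λ k i → ≤-reflexive (≈-sym (+-identityˡ _)))

    module _ (l r : ℕ → ℝ) (l-inc : ∀ k → l k ≤ l (suc k)) (r-dec : ∀ k → r (suc k) ≤ r k)
             (t : ℝ) (squeeze : ∀ {x} → (∀ k → l k < x × x ≤ r k) → x ≈ t) where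

      -- Atomlessness enters here: the intervals (l k, r k] shrink to {t}.
      cdfs-close : ∀ {ε} → 0# < ε → ∃[ k ] product (cdf (r k)) < product (cdf (l k)) + ε
      cdfs-close = products-close
        between (λ k (lower , upper) → ≤-<-trans (l-inc k) lower , ≤-trans upper (r-dec k))
        (borel-singleton t) (λ i → atomless i t (borel-singleton t)) squeeze
        (λ k → cdf-∈[0,1] (l k)) (λ k → cdf-∈[0,1] (r k))
        (λ k i → D.Pr-∪-≤ i (borel-below (l k)) (between k) (borel-below (r k))
          λ {x} x≤r → Sum.map₂ (_, x≤r) (below-or-above (l k) x))
        where
        between : ∀ k → Borelian (Above (l k) ∩ Below (r k))
        between k = m-∩ (borel-above (l k)) (borel-below (r k))

    abstract
      product-cdf-continuous : ∀ t {ε} → 0# < ε →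
                               ∃[ k ] product (cdf (t + δ k)) < product (cdf (t - δ k)) + ε
      product-cdf-continuous t = cdfs-close (λ k → t - δ k) (λ k → t + δ k)
        (λ k → ≤-by (gap (δ-dec k)) (solve 3 (λ t d d′ → (t :- d′) :- (t :- d) := d :- d′) ≈-refl t (δ k) (δ (suc k))))
        (λ k → ≤-by (gap (δ-dec k)) (solve 3 (λ t d d′ → (t :+ d) :- (t :+ d′) := d :- d′) ≈-refl t (δ k) (δ (suc k))))
        t squeeze
        where
        δ-dec : ∀ k → δ (suc k) ≤ δ k
        δ-dec k = δ-mono (ℕ.n≤1+n k)

        squeeze : ∀ {x} → (∀ k → t - δ k < x × x ≤ t + δ k) → x ≈ t
        squeeze {x} x∈ = antisym
          (≮⇒≥ λ t<x → let k , δ<x-t = δ-small (gap< t<x) in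
            <⇒≱ δ<x-t (≤-by (gap (proj₂ (x∈ k))) (solve 3 (λ t x d → d :- (x :- t) := (t :+ d) :- x) ≈-refl t x (δ k))))
          (≮⇒≥ λ x<t → let k , δ<t-x = δ-small (gap< x<t) in
            <⇒≱ δ<t-x (≤-by (gap (<⇒≤ (proj₁ (x∈ k)))) (solve 3 (λ t x d → d :- (t :- x) := x :- (t :- d)) ≈-refl t x (δ k))))

    fromℕ-inc : ∀ k → fromℕ k ≤ fromℕ (suc k)
    fromℕ-inc k = fromℕ-mono-≤ (ℕ.n≤1+n k)

    -fromℕ-dec : ∀ k → - fromℕ (suc k) ≤ - fromℕ k
    -fromℕ-dec k = ≤-by (gap (fromℕ-inc k)) (solve 2 (λ m m′ → :- m :- (:- m′) := m′ :- m) ≈-refl (fromℕ k) (fromℕ (suc k)))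

    -fromℕ-unbounded : ∀ x → ∃[ k ] - fromℕ k < x
    -fromℕ-unbounded x = let k , -x<k = archimedean (- x) in
      k , <-by (gap< -x<k) (solve 2 (λ m x → x :- (:- m) := m :- :- x) ≈-refl (fromℕ k) x)

    abstract
      product-cdf-top : ∀ {ε} → 0# < ε → ∃[ k ] 1# < product (cdf (fromℕ k)) + ε
      product-cdf-top 0<ε = Product.map₂ (≤-<-trans (≤-reflexive (≈-sym (product-1 (suc n)))))
        (ones-close fromℕ fromℕ-inc archimedean 0<ε)

      product-cdf-bottom : ∀ {ε} → 0# < ε → ∃[ k ] product (cdf (- fromℕ k)) < ε
      -- The product of zeros vanishes because there is at least one factor; an empty product would
      -- be 1.
      product-cdf-bottom 0<ε = Product.map₂ (λ close → <-≤-trans close (≤-reflexive (≈-trans (+-congʳ (zeroˡ _)) (+-identityˡ _))))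
        (zeros-close (λ k → - fromℕ k) -fromℕ-dec -fromℕ-unbounded 0<ε)

    product-cdf-surjective : ∀ {c} → 0# < c → c < 1# → ∃[ t ] product (cdf t) ≈ c
    product-cdf-surjective = intermediate-value (λ t → product (cdf t))
      product-cdf-mono product-cdf-continuous product-cdf-top product-cdf-bottom

  -- The threshold rule and its stopping time

  -- Observing times 0, …, k, the last observed value is the one presented at
  -- time k.
  observed-last : ∀ {n} (y : Vector ℝ n) k → observed y k (Fin.fromℕ (toℕ k)) ≡ y k
  observed-last y k = ≡.cong y (Fin.toℕ-injective (≡.trans (Fin.toℕ-inject≤ _ _) (Fin.toℕ-fromℕ (toℕ k))))

  -- A rule answers with a Boolean, so the comparison with the threshold is decided by excluded
  -- middle.
  above? : ∀ t x → Dec (t < x)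
  above? t x = em

  -- The rule accepts every value above `t`; that only the first acceptance counts is part of
  -- `StopsAt`. Its acceptance sets are measurable because they are open: around an accepted vector,
  -- the excess of the last coordinate over `t` is a suitable radius.
  thresholdRule : ∀ {n} → ℝ → OnlineRule n
  thresholdRule t = record
    { choose     = λ k v → does (above? t (v (Fin.fromℕ (toℕ k))))
    ; measurable = λ k → let last = Fin.fromℕ (toℕ k) in resp-≐
        ((λ {v} t<v → dec-true (above? t (v last)) t<v) , λ {v} → does-true (above? t (v last)))
        (basic λ {v} t<v → v last - t , gap< t<v , λ {w} near →
          ≤-<-trans (≤-reflexive (solve 2 (λ t x → t := x :- (x :- t)) ≈-refl t (v last))) (proj₁ (near last)))
    }
    where
    does-true : ∀ {P : Set} (P? : Dec P) → does P? ≡ true → P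
    does-true (yes p) _ = p

  module _ {n} (t : ℝ) (y : Vector ℝ n) where

    open OnlineRule (thresholdRule {n} t)

    ThresholdStopsAt : Fin n → Set
    ThresholdStopsAt k = t < y k × (∀ j → j Fin.< k → y j ≤ t)

    stopsAt : ∀ {k} → ThresholdStopsAt k → StopsAt (thresholdRule t) y k
    stopsAt {k} (t<y , y≤t) = chosen k t<y , λ j j<k → rejected j (y≤t j j<k)
      where
      chosen : ∀ k → t < y k → choose k (observed y k) ≡ true
      chosen k t<y = dec-true (above? t _) (≡.subst (t <_) (≡.sym (observed-last y k)) t<y)
      rejected : ∀ k → y k ≤ t → choose k (observed y k) ≡ false
      rejected k y≤t = dec-false (above? t _) λ t<y → <⇒≱ t<y (≡.subst (_≤ t) (≡.sym (observed-last y k)) y≤t)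

    stopsAt⁻¹ : ∀ {k} → StopsAt (thresholdRule t) y k → ThresholdStopsAt k
    stopsAt⁻¹ {k} (chosen , rejected) =
      decidable-stable (above? t (y k)) (λ t≮y → true≢false (≡.trans (≡.sym chosen)
        (dec-false (above? t _) (t≮y ∘ ≡.subst (t <_) (observed-last y k))))) ,
      λ j j<k → ≮⇒≥ λ t<y → true≢false (≡.trans (≡.sym
        (dec-true (above? t _) (≡.subst (t <_) (≡.sym (observed-last y j)) t<y))) (rejected j j<k))
      where
      true≢false : true ≢ false
      true≢false ()

  -- Measurability and probability of success

  module Success {e} (e-euler : IsEuler e) {n} (I : Instance (suc n)) (t : ℝ)
    (∏cdf≈e⁻¹ : product (Threshold.cdf I t) ≈ e ⁻¹)
    (π : Permutation′ (suc n)) {Ω : Set} (𝓕 : σ-Algebra Ω) (P : ProbabilityMeasure 𝓕)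
    (X : Vector (RandomVariable 𝓕 P) (suc n)) (independent : Independent 𝓕 P X)
    (law : ∀ i → HasLaw 𝓕 P (X i) (Instance.dist I i)) where

    open Instance I
    open Threshold I
    open BorelSets
    open MeasurableSets 𝓕
    open Measure 𝓕 P
    open ProbabilityMeasure using (Pr)
    open RandomVariable
    open σ-Algebra using (Measurable)

    private
      x y : Ω → Vector ℝ (suc n)
      x ω i = value (X i) ω
      y ω k = x ω (π ⟨$⟩ʳ k)

      -- The succeeding event compares the variables with each other; a countable
      -- dense set reduces this to comparisons with constants.
      m-< : ∀ i j → Measurable 𝓕 (λ ω → x ω i < x ω j)
      m-< i j = σ-Algebra.resp-≐ 𝓕
        ( (λ (k , a , b , xᵢ≤g , g<xⱼ) → ≤-<-trans xᵢ≤g g<xⱼ)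
        , (λ xᵢ<xⱼ → let k , a , b , xᵢ<g , g<xⱼ = grid-dense xᵢ<xⱼ in k , a , b , <⇒≤ xᵢ<g , g<xⱼ))
        (σ-Algebra.union 𝓕 λ k → σ-Algebra.union 𝓕 λ a → σ-Algebra.union 𝓕 λ b →
          m-∩ (measurable (X i) (borel-below (grid k a b))) (measurable (X j) (borel-above (grid k a b))))

      m-≤ : ∀ i j → Measurable 𝓕 (λ ω → x ω i ≤ x ω j)
      m-≤ i j = σ-Algebra.resp-≐ 𝓕 (≮⇒≥ , λ xᵢ≤xⱼ xⱼ<xᵢ → <⇒≱ xⱼ<xᵢ xᵢ≤xⱼ) (σ-Algebra.compl 𝓕 (m-< j i))

      m-≈ : ∀ i j → Measurable 𝓕 (λ ω → x ω i ≈ x ω j)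
      m-≈ i j = σ-Algebra.resp-≐ 𝓕
        ((λ (xᵢ≤xⱼ , xⱼ≤xᵢ) → antisym xᵢ≤xⱼ xⱼ≤xᵢ) , λ xᵢ≈xⱼ → ≤-reflexive xᵢ≈xⱼ , ≤-reflexive (≈-sym xᵢ≈xⱼ))
        (m-∩ (m-≤ i j) (m-≤ j i))

      m-stops : ∀ k → Measurable 𝓕 (λ ω → StopsAt (thresholdRule t) (y ω) k)
      m-stops k = σ-Algebra.resp-≐ 𝓕 ((λ {ω} → stopsAt t (y ω)) , λ {ω} → stopsAt⁻¹ t (y ω))
        (m-∩ (measurable (X (π ⟨$⟩ʳ k)) (borel-above t))
             (m-∀ λ j → m-→ (measurable (X (π ⟨$⟩ʳ j)) (borel-below t))))

    m-succeeds : Measurable 𝓕 (λ ω → Succeeds (thresholdRule t) π (x ω))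
    m-succeeds = m-∃ λ k → m-∩ (m-stops k)
      (m-∩ (m-∃ λ i → m-≈ (π ⟨$⟩ʳ k) i) (m-∀ λ i → m-≤ i (π ⟨$⟩ʳ k)))

    private
      -- Phrases "only value i exceeds t" as one Borel condition per variable, the form to which
      -- `Independent` applies. Taking the decision as an argument lets later proofs split on it.
      Side : ∀ {i j : Fin (suc n)} → Dec (j ≡ i) → Pred ℝ 0ℓ
      Side (yes _) = Above t
      Side (no  _) = Below t

      borel-side : ∀ {i j} (d : Dec (j ≡ i)) → Borelian (Side d)
      borel-side (yes _) = borel-above t
      borel-side (no  _) = borel-below t

      OnlyAbove : Fin (suc n) → Pred Ω 0ℓ
      OnlyAbove i ω = ∀ j → Side (j Fin.≟ i) (x ω j)

      m-onlyAbove : ∀ i → Measurable 𝓕 (OnlyAbove i)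
      m-onlyAbove i = m-∀ λ j → measurable (X j) (borel-side (j Fin.≟ i))

      above : ∀ {i ω} → OnlyAbove i ω → t < x ω i
      above {i} {ω} only = at (i Fin.≟ i) (only i)
        where
        at : (d : Dec (i ≡ i)) → Side d (x ω i) → t < x ω i
        at (yes _)  t<x = t<x
        at (no i≢i) _   = contradiction ≡.refl i≢i

      below : ∀ {i j ω} → j ≢ i → OnlyAbove i ω → x ω j ≤ t
      below {i} {j} {ω} j≢i only = at (j Fin.≟ i) (only j)
        where
        at : (d : Dec (j ≡ i)) → Side d (x ω j) → x ω j ≤ t
        at (yes j≡i) _   = contradiction j≡i j≢i
        at (no _)    x≤t = x≤t

      onlyAbove-disjoint : ∀ {i j} → i ≢ j → OnlyAbove i ⊥ OnlyAbove j
      onlyAbove-disjoint i≢j (onlyᵢ , onlyⱼ) = <⇒≱ (above onlyᵢ) (below i≢j onlyⱼ)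

      onlyAbove⊆succeeds : ∀ i → OnlyAbove i ⊆ (λ ω → Succeeds (thresholdRule t) π (x ω))
      onlyAbove⊆succeeds i {ω} only = k , stopsAt t (y ω) (t<y , others) , (i , ≈-reflexive y≡x) ,
        λ j → case j Fin.≟ i of λ where
          (yes ≡.refl) → ≤-reflexive (≈-reflexive (≡.sym y≡x))
          (no j≢i)     → ≤-trans (below j≢i only) (<⇒≤ t<y)
        where
        k = π ⟨$⟩ˡ i
        y≡x : y ω k ≡ x ω i
        y≡x = ≡.cong (x ω) (Permutation.inverseʳ π)
        t<y : t < y ω k
        t<y = ≡.subst (t <_) (≡.sym y≡x) (above only)
        others : ∀ j → j Fin.< k → y ω j ≤ t
        others j j<k = below (λ πj≡i → Fin.<⇒≢ j<k
          (≡.trans (≡.sym (Permutation.inverseˡ π)) (≡.cong (π ⟨$⟩ˡ_) πj≡i))) only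

      q a : Vector ℝ (suc n)
      q = cdf t
      a i = q i ⁻¹ - 1#

      -- Needed for aᵢ to have its meaning, as inverses are constrained only away from zero. A
      -- vanishing qᵢ would make the product vanish, but that product is e⁻¹ > 0.
      0<q : ∀ i → 0# < q i
      0<q i = proj₁ (cdf-∈[0,1] t i) , product≉0⇒factor≉0 {x = q}
        (λ P≈0 → >⇒≉ (0<e⁻¹ e-euler) (≈-trans (≈-sym ∏cdf≈e⁻¹) P≈0)) i ∘ ≈-sym

      [1+a]q≈1 : ∀ i → (1# + a i) * q i ≈ 1#
      [1+a]q≈1 i = ≈-trans (solve 2 (λ q r → (:1 :+ (r :- :1)) :* q := q :* r) ≈-refl (q i) (q i ⁻¹)) (pos-inverse (0<q i))

      1-q≈aq : ∀ i → 1# - q i ≈ a i * q i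
      1-q≈aq i = ≈-trans (+-congʳ (≈-sym ([1+a]q≈1 i)))
        (solve 2 (λ a q → (:1 :+ a) :* q :- q := a :* q) ≈-refl (a i) (q i))

      0≤a : ∀ i → 0# ≤ a i
      0≤a i = gap (begin
        1#            ≈⟨ pos-inverse (0<q i) ⟨
        q i * q i ⁻¹  ≤⟨ *-monoʳ-≤ (<⇒≤ (⁻¹-pos (0<q i))) (proj₂ (cdf-∈[0,1] t i)) ⟩
        1# * q i ⁻¹   ≈⟨ *-identityˡ _ ⟩
        q i ⁻¹        ∎)
        where open ≤-Reasoning

      ∏[1+a]≈e : product (λ i → 1# + a i) ≈ e
      ∏[1+a]≈e = inverse-unique (begin
          e ⁻¹ * product (λ i → 1# + a i)        ≈⟨ *-congʳ ∏cdf≈e⁻¹ ⟨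
          product q * product (λ i → 1# + a i)   ≈⟨ *-comm _ _ ⟩
          product (λ i → 1# + a i) * product q   ≈⟨ product-* (λ i → 1# + a i) q ⟨
          product (λ i → (1# + a i) * q i)       ≈⟨ product-cong [1+a]q≈1 ⟩
          product {suc n} (λ _ → 1#)             ≈⟨ product-1 (suc n) ⟩
          1#                                     ∎)
        (≈-trans (*-comm _ _) (pos-inverse (0<e e-euler)))
        where open import Relation.Binary.Reasoning.Setoid setoid

      Pr-above : ∀ i (d : Dec (i ≡ i)) → Pr (dist i) (borel-side d) ≈ a i * q i
      Pr-above i (yes _)  = ≈-trans
        (D.Pr-∁ i (borel-below t) (borel-above t) ((λ t<x → <⇒≱ t<x) , ≰⇒>)) (1-q≈aq i)
      Pr-above i (no i≢i) = contradiction ≡.refl i≢i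

      Pr-below : ∀ {i} j (d : Dec (j ≡ i)) → j ≢ i → Pr (dist j) (borel-side d) ≈ q j
      Pr-below j (yes j≡i) j≢i = contradiction j≡i j≢i
      Pr-below j (no _)    _   = ≈-refl

      Pr-onlyAbove : ∀ i → Pr P (m-onlyAbove i) ≈ a i * e ⁻¹
      Pr-onlyAbove i = begin
        Pr P (m-onlyAbove i)                                            ≈⟨ independent (λ j → borel-side (j Fin.≟ i)) (m-onlyAbove i) ⟩
        product (λ j → Pr P (measurable (X j) (borel-side (j Fin.≟ i))))  ≈⟨ product-cong (λ j → law j (borel-side (j Fin.≟ i))) ⟩
        product (λ j → Pr (dist j) (borel-side (j Fin.≟ i)))             ≈⟨ product-scale-at i (Pr-above i (i Fin.≟ i)) (λ j → Pr-below j (j Fin.≟ i)) ⟩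
        a i * product q                                                 ≈⟨ *-congˡ ∏cdf≈e⁻¹ ⟩
        a i * e ⁻¹                                                      ∎
        where open import Relation.Binary.Reasoning.Setoid setoid

    e⁻¹≤Pr-succeeds : e ⁻¹ ≤ Pr P m-succeeds
    e⁻¹≤Pr-succeeds = begin
      e ⁻¹                               ≈⟨ *-identityˡ _ ⟨
      1# * e ⁻¹                          ≤⟨ *-monoʳ-≤ (<⇒≤ (0<e⁻¹ e-euler)) (1≤sum e-euler 0≤a (≤-reflexive (≈-sym ∏[1+a]≈e))) ⟩
      sum a * e ⁻¹                       ≈⟨ *-distribʳ-sum (e ⁻¹) a ⟩
      sum (λ i → a i * e ⁻¹)             ≈⟨ sum-cong-≋ Pr-onlyAbove ⟨
      -- Only an inequality: the rule may also succeed when several values exceed the threshold, and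
      -- that contribution is dropped.
      sum (λ i → Pr P (m-onlyAbove i))   ≤⟨ sum-Pr≤Pr m-onlyAbove m-succeeds onlyAbove-disjoint onlyAbove⊆succeeds ⟩
      Pr P m-succeeds                    ∎
      where open ≤-Reasoning

  -- The algorithm

  module _ {e} (e-euler : IsEuler e) where

    threshold : ∀ {n} (I : Instance (suc n)) → ∃[ t ] product (Threshold.cdf I t) ≈ e ⁻¹
    threshold I = Threshold.product-cdf-surjective I (0<e⁻¹ e-euler) (e⁻¹<1 e-euler)

    thresholdAlgorithm : Algorithm
    -- A placeholder: with no values nothing is ever presented. The guarantee concerns positive `n`,
    -- as the empty product 1 never equals `e ⁻¹`.
    thresholdAlgorithm {zero}  I = thresholdRule 0#
    thresholdAlgorithm {suc n} I = thresholdRule (proj₁ (threshold I))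

    thresholdAlgorithm-succeeds : ∀ n → NonZero n → (I : Instance n) →
      SucceedsWithProbabilityAtLeast (e ⁻¹) (thresholdAlgorithm I) I
    thresholdAlgorithm-succeeds (suc n) _ I π 𝓕 P X independent law = m-succeeds , e⁻¹≤Pr-succeeds
      where open Success e-euler I (proj₁ (threshold I)) (proj₂ (threshold I)) π 𝓕 P X independent law

theorem1 : ExcludedMiddle 0ℓ →
    (ℝ : CompleteOrderedField) →
    let open CompleteOrderedField ℝ
        open BestChoice ℝ
    in
    (e : Carrier) → IsEuler e →
    Σ[ alg ∈ Algorithm ]
      (∀ (n : ℕ) → NonZero n → (I : Instance n) →
        SucceedsWithProbabilityAtLeast (e ⁻¹) (alg I) I)
theorem1 em ℝ e e-euler = thresholdAlgorithm em ℝ e-euler , thresholdAlgorithm-succeeds em ℝ e-euler
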